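{- For every integer $t$, there exists a connected bipartite graph whose adjacency matrix has exactly five distinct eigenvalues and which has at least $t$ distinct valencies (vertex degrees).
   Context: Eigenvalues of a graph are the eigenvalues of its adjacency matrix. Graphs are finite, simple and undirected. -}

module Defs where

open import Algebra.Bundles using (RawRing)
import Algebra.Definitions.RawMonoid as RawMonoidOps
open import Data.Bool.Base using (Bool; if_then_else_)
open import Data.Fin.Base using (Fin)
open import Data.List.Base using (List; length; filter; map; deduplicate; allFin)
open import Data.Nat.Base as ℕ using (ℕ)
import Data.Nat.Properties as ℕₚ
open import Data.Product.Base using (Σ-syntax; ∃-syntax; _×_; _,_)
open import Data.Rational.Base as ℚ using (ℚ; 0ℚ; 1ℚ; ½; ∣_∣)
import Data.Rational.Properties as ℚₚ
open import Data.Rational.Solver using (module +-*-Solver)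
open import Data.Vec.Functional using (Vector)
open import Level using (0ℓ)
open import Relation.Binary.Construct.Closure.ReflexiveTransitive using (Star)
open import Relation.Binary.Core using (Rel)
open import Relation.Binary.Definitions using (Decidable; Irreflexive; Symmetric)
open import Relation.Binary.PropositionalEquality
  using (_≡_; _≢_; refl; sym; trans; cong; subst)
open import Relation.Nullary.Decidable.Core using (does)

-- The real numbers, as Cauchy sequences of rationals with the setoid
-- equality _≈_ and the apartness relation _#_ (which over classical logic
-- is just the negation of _≈_).

IsCauchy : (ℕ → ℚ) → Set
IsCauchy x =
  ∀ ε → 0ℚ ℚ.< ε → ∃[ N ] ∀ m n → N ℕ.≤ m → N ℕ.≤ n → ∣ x m ℚ.- x n ∣ ℚ.< ε

record ℝ : Set where
  constructor mkℝ
  field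
    seq    : ℕ → ℚ
    cauchy : IsCauchy seq

open ℝ public

infix 4 _≈_ _#_

_≈_ : Rel ℝ 0ℓ
x ≈ y =
  ∀ ε → 0ℚ ℚ.< ε → ∃[ N ] ∀ n → N ℕ.≤ n → ∣ seq x n ℚ.- seq y n ∣ ℚ.< ε

_#_ : Rel ℝ 0ℓ
x # y =
  ∃[ ε ] (0ℚ ℚ.< ε × ∃[ N ] ∀ n → N ℕ.≤ n → ε ℚ.≤ ∣ seq x n ℚ.- seq y n ∣)

private

  open +-*-Solver using (solve; _:=_; _:+_; _:*_; _:-_; :-_)

  neg-sub : ∀ a b → ℚ.- (a ℚ.- b) ≡ ℚ.- a ℚ.- ℚ.- b
  neg-sub = solve 2 (λ a b → :- (a :- b) := :- a :- :- b) refl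

  telescope : ∀ a b → a ≡ (a ℚ.- b) ℚ.+ b
  telescope = solve 2 (λ a b → a := (a :- b) :+ b) refl

  +-sub : ∀ a b c d → (a ℚ.+ b) ℚ.- (c ℚ.+ d) ≡ (a ℚ.- c) ℚ.+ (b ℚ.- d)
  +-sub = solve 4 (λ a b c d → (a :+ b) :- (c :+ d) := (a :- c) :+ (b :- d)) refl

  *-sub : ∀ a b c d → a ℚ.* b ℚ.- c ℚ.* d ≡ a ℚ.* (b ℚ.- d) ℚ.+ d ℚ.* (a ℚ.- c)
  *-sub = solve 4 (λ a b c d → a :* b :- c :* d := a :* (b :- d) :+ d :* (a :- c)) refl

  halves : ∀ ε → ½ ℚ.* ε ℚ.+ ½ ℚ.* ε ≡ ε
  halves ε = trans (sym (ℚₚ.*-distribʳ-+ ε ½ ½)) (ℚₚ.*-identityˡ ε)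

  0<½*ε : ∀ {ε} → 0ℚ ℚ.< ε → 0ℚ ℚ.< ½ ℚ.* ε
  0<½*ε {ε} 0<ε =
    ℚₚ.positive⁻¹ (½ ℚ.* ε) {{ℚₚ.pos*pos⇒pos ½ ε {{ℚ.positive 0<ε}}}}

  const-cauchy : ∀ q → IsCauchy (λ _ → q)
  const-cauchy q ε 0<ε =
    0 , λ _ _ _ _ → subst (λ d → ∣ d ∣ ℚ.< ε) (sym (ℚₚ.+-inverseʳ q)) 0<ε

  neg-cauchy : ∀ {x} → IsCauchy x → IsCauchy (λ n → ℚ.- x n)
  neg-cauchy {x} cx ε 0<ε with cx ε 0<ε
  ... | N , close = N , λ m n N≤m N≤n →
    subst (ℚ._< ε)
      (trans (sym (ℚₚ.∣-p∣≡∣p∣ (x m ℚ.- x n)))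
             (cong ∣_∣ (neg-sub (x m) (x n))))
      (close m n N≤m N≤n)

  +-cauchy : ∀ {x y} → IsCauchy x → IsCauchy y → IsCauchy (λ n → x n ℚ.+ y n)
  +-cauchy {x} {y} cx cy ε 0<ε
    with cx (½ ℚ.* ε) (0<½*ε 0<ε) | cy (½ ℚ.* ε) (0<½*ε 0<ε)
  ... | M , closeˣ | N , closeʸ = M ℕ.⊔ N , λ m n ≤m ≤n → begin-strict
    ∣ (x m ℚ.+ y m) ℚ.- (x n ℚ.+ y n) ∣
      ≡⟨ cong ∣_∣ (+-sub (x m) (y m) (x n) (y n)) ⟩
    ∣ (x m ℚ.- x n) ℚ.+ (y m ℚ.- y n) ∣
      ≤⟨ ℚₚ.∣p+q∣≤∣p∣+∣q∣ (x m ℚ.- x n) (y m ℚ.- y n) ⟩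
    ∣ x m ℚ.- x n ∣ ℚ.+ ∣ y m ℚ.- y n ∣
      <⟨ ℚₚ.+-mono-< (closeˣ m n (ℕₚ.m⊔n≤o⇒m≤o M N ≤m) (ℕₚ.m⊔n≤o⇒m≤o M N ≤n))
                     (closeʸ m n (ℕₚ.m⊔n≤o⇒n≤o M N ≤m) (ℕₚ.m⊔n≤o⇒n≤o M N ≤n)) ⟩
    ½ ℚ.* ε ℚ.+ ½ ℚ.* ε
      ≡⟨ halves ε ⟩
    ε ∎
    where open ℚₚ.≤-Reasoning

  bounded : ∀ {x} → IsCauchy x →
            ∃[ B ] (0ℚ ℚ.< B × ∃[ N ] ∀ n → N ℕ.≤ n → ∣ x n ∣ ℚ.≤ B)
  bounded {x} cx with cx 1ℚ (ℚₚ.positive⁻¹ 1ℚ)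
  ... | N , close = B , 0<B , N , λ n N≤n → begin
    ∣ x n ∣
      ≡⟨ cong ∣_∣ (telescope (x n) (x N)) ⟩
    ∣ (x n ℚ.- x N) ℚ.+ x N ∣
      ≤⟨ ℚₚ.∣p+q∣≤∣p∣+∣q∣ (x n ℚ.- x N) (x N) ⟩
    ∣ x n ℚ.- x N ∣ ℚ.+ ∣ x N ∣
      ≤⟨ ℚₚ.+-monoˡ-≤ ∣ x N ∣ (ℚₚ.<⇒≤ (close n N N≤n ℕₚ.≤-refl)) ⟩
    B ∎
    where
    open ℚₚ.≤-Reasoning
    B = 1ℚ ℚ.+ ∣ x N ∣
    0<B : 0ℚ ℚ.< B
    0<B = ℚₚ.+-mono-<-≤ (ℚₚ.positive⁻¹ 1ℚ) (ℚₚ.0≤∣p∣ (x N))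

  product< : ∀ {A D} p q → 0ℚ ℚ.< A →
             ∣ p ∣ ℚ.≤ A → ∣ q ∣ ℚ.< D → ∣ p ℚ.* q ∣ ℚ.< A ℚ.* D
  product< {A} {D} p q 0<A p≤ q< = begin-strict
    ∣ p ℚ.* q ∣     ≡⟨ ℚₚ.∣p*q∣≡∣p∣*∣q∣ p q ⟩
    ∣ p ∣ ℚ.* ∣ q ∣ ≤⟨ ℚₚ.*-monoʳ-≤-nonNeg ∣ q ∣ {{ℚₚ.∣-∣-nonNeg q}} p≤ ⟩
    A ℚ.* ∣ q ∣     <⟨ ℚₚ.*-monoʳ-<-pos A {{ℚ.positive 0<A}} q< ⟩
    A ℚ.* D         ∎
    where open ℚₚ.≤-Reasoning

  divide : ∀ s ε → 0ℚ ℚ.< s → 0ℚ ℚ.< ε → ∃[ δ ] (0ℚ ℚ.< δ × s ℚ.* δ ≡ ε)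
  divide s ε 0<s 0<ε = s⁻¹ ℚ.* ε
    , ℚₚ.positive⁻¹ (s⁻¹ ℚ.* ε)
        {{ℚₚ.pos*pos⇒pos s⁻¹ {{ℚₚ.1/pos⇒pos s {{s-pos}}}} ε {{ℚ.positive 0<ε}}}}
    , trans (sym (ℚₚ.*-assoc s s⁻¹ ε))
        (trans (cong (ℚ._* ε) (ℚₚ.*-inverseʳ s {{s≢0}})) (ℚₚ.*-identityˡ ε))
    where
    s-pos = ℚ.positive 0<s
    s≢0   = ℚₚ.pos⇒nonZero s {{s-pos}}
    s⁻¹   = ℚ.1/_ s {{s≢0}}

  *-close : ∀ a b c d {B C δ} → 0ℚ ℚ.< B → 0ℚ ℚ.< C → ∣ a ∣ ℚ.≤ B → ∣ d ∣ ℚ.≤ C →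
            ∣ a ℚ.- c ∣ ℚ.< δ → ∣ b ℚ.- d ∣ ℚ.< δ →
            ∣ a ℚ.* b ℚ.- c ℚ.* d ∣ ℚ.< (B ℚ.+ C) ℚ.* δ
  *-close a b c d {B} {C} {δ} 0<B 0<C a≤B d≤C a-c<δ b-d<δ = begin-strict
    ∣ a ℚ.* b ℚ.- c ℚ.* d ∣
      ≡⟨ cong ∣_∣ (*-sub a b c d) ⟩
    ∣ a ℚ.* (b ℚ.- d) ℚ.+ d ℚ.* (a ℚ.- c) ∣
      ≤⟨ ℚₚ.∣p+q∣≤∣p∣+∣q∣ (a ℚ.* (b ℚ.- d)) (d ℚ.* (a ℚ.- c)) ⟩
    ∣ a ℚ.* (b ℚ.- d) ∣ ℚ.+ ∣ d ℚ.* (a ℚ.- c) ∣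
      <⟨ ℚₚ.+-mono-< {∣ a ℚ.* (b ℚ.- d) ∣} {B ℚ.* δ} {∣ d ℚ.* (a ℚ.- c) ∣} {C ℚ.* δ}
           (product< {B} {δ} a (b ℚ.- d) 0<B a≤B b-d<δ)
           (product< {C} {δ} d (a ℚ.- c) 0<C d≤C a-c<δ) ⟩
    B ℚ.* δ ℚ.+ C ℚ.* δ
      ≡⟨ sym (ℚₚ.*-distribʳ-+ δ B C) ⟩
    (B ℚ.+ C) ℚ.* δ ∎
    where open ℚₚ.≤-Reasoning

  EventuallyBoundedBy : (ℕ → ℚ) → ℚ → Set
  EventuallyBoundedBy x B = ∃[ N ] ∀ n → N ℕ.≤ n → ∣ x n ∣ ℚ.≤ B

  EventuallyWithin : ℚ → (ℕ → ℚ) → Set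
  EventuallyWithin ε x =
    ∃[ N ] ∀ m n → N ℕ.≤ m → N ℕ.≤ n → ∣ x m ℚ.- x n ∣ ℚ.< ε

  *-within : ∀ {x y B C δ} → 0ℚ ℚ.< B → 0ℚ ℚ.< C →
             EventuallyBoundedBy x B → EventuallyBoundedBy y C →
             EventuallyWithin δ x → EventuallyWithin δ y →
             EventuallyWithin ((B ℚ.+ C) ℚ.* δ) (λ n → x n ℚ.* y n)
  *-within {x} {y} {B} {C} {δ} 0<B 0<C (K , ∣x∣≤B) (L , ∣y∣≤C) (M , closeˣ) (N , closeʸ) =
    (K ℕ.⊔ L) ℕ.⊔ (M ℕ.⊔ N) , λ m n ≤m ≤n →
      let MN≤m = ℕₚ.m⊔n≤o⇒n≤o (K ℕ.⊔ L) (M ℕ.⊔ N) ≤m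
          MN≤n = ℕₚ.m⊔n≤o⇒n≤o (K ℕ.⊔ L) (M ℕ.⊔ N) ≤n
      in *-close (x m) (y m) (x n) (y n) {B} {C} {δ} 0<B 0<C
           (∣x∣≤B m (ℕₚ.m⊔n≤o⇒m≤o K L (ℕₚ.m⊔n≤o⇒m≤o (K ℕ.⊔ L) (M ℕ.⊔ N) ≤m)))
           (∣y∣≤C n (ℕₚ.m⊔n≤o⇒n≤o K L (ℕₚ.m⊔n≤o⇒m≤o (K ℕ.⊔ L) (M ℕ.⊔ N) ≤n)))
           (closeˣ m n (ℕₚ.m⊔n≤o⇒m≤o M N MN≤m) (ℕₚ.m⊔n≤o⇒m≤o M N MN≤n))
           (closeʸ m n (ℕₚ.m⊔n≤o⇒n≤o M N MN≤m) (ℕₚ.m⊔n≤o⇒n≤o M N MN≤n))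

  *-cauchy : ∀ {x y} → IsCauchy x → IsCauchy y → IsCauchy (λ n → x n ℚ.* y n)
  *-cauchy {x} {y} cx cy ε 0<ε =
    let B , 0<B , ∣x∣≤B = bounded {x} cx
        C , 0<C , ∣y∣≤C = bounded {y} cy
        δ , 0<δ , [B+C]δ≡ε = divide (B ℚ.+ C) ε (ℚₚ.+-mono-< 0<B 0<C) 0<ε
    in subst (λ η → EventuallyWithin η (λ n → x n ℚ.* y n)) [B+C]δ≡ε
         (*-within {x} {y} 0<B 0<C ∣x∣≤B ∣y∣≤C (cx δ 0<δ) (cy δ 0<δ))

infix  8 -_
infixl 7 _*_
infixl 6 _+_

0ℝ 1ℝ : ℝ
0ℝ = mkℝ (λ _ → 0ℚ) (const-cauchy 0ℚ)
1ℝ = mkℝ (λ _ → 1ℚ) (const-cauchy 1ℚ)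

-_ : ℝ → ℝ
- x = mkℝ (λ n → ℚ.- seq x n) (neg-cauchy {seq x} (cauchy x))

_+_ _*_ : ℝ → ℝ → ℝ
x + y = mkℝ (λ n → seq x n ℚ.+ seq y n) (+-cauchy {seq x} {seq y} (cauchy x) (cauchy y))
x * y = mkℝ (λ n → seq x n ℚ.* seq y n) (*-cauchy {seq x} {seq y} (cauchy x) (cauchy y))

ℝ-rawRing : RawRing 0ℓ 0ℓ
ℝ-rawRing = record
  { Carrier = ℝ
  ; _≈_     = _≈_
  ; _+_     = _+_
  ; _*_     = _*_
  ; -_      = -_
  ; 0#      = 0ℝ
  ; 1#      = 1ℝ
  }

open RawMonoidOps (RawRing.+-rawMonoid ℝ-rawRing) public using (sum)

Matrix : ℕ → Set
Matrix n = Fin n → Fin n → ℝ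

-- The matrices of interest are real symmetric, so their eigenvalues are all
-- real and it suffices to speak of real eigenvalues and eigenvectors.
-- A vector is nonzero when some coordinate is apart from 0.

IsEigenvalue : ∀ {n} → Matrix n → ℝ → Set
IsEigenvalue {n} A μ =
  Σ[ v ∈ Vector ℝ n ] (∃[ i ] v i # 0ℝ) × (∀ i → sum (λ j → A i j * v j) ≈ μ * v i)

HasExactlyDistinctEigenvalues : ∀ {n} → ℕ → Matrix n → Set
HasExactlyDistinctEigenvalues k A =
  Σ[ θ ∈ Vector ℝ k ] (∀ i j → i ≢ j → θ i # θ j)
       × (∀ i → IsEigenvalue A (θ i))
       × (∀ μ → IsEigenvalue A μ → ∃[ i ] μ ≈ θ i)

record Graph : Set₁ where
  field
    order    : ℕ
    _~_      : Rel (Fin order) 0ℓ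
    _~?_     : Decidable _~_
    ~-sym    : Symmetric _~_
    ~-irrefl : Irreflexive _≡_ _~_

  Vertex : Set
  Vertex = Fin order

  adjacencyMatrix : Matrix order
  adjacencyMatrix u v = if does (u ~? v) then 1ℝ else 0ℝ

  valency : Vertex → ℕ
  valency u = length (filter (u ~?_) (allFin order))

  distinctValencies : List ℕ
  distinctValencies = deduplicate ℕₚ._≟_ (map valency (allFin order))

  Connected : Set
  Connected = ∀ u v → Star _~_ u v

  Bipartite : Set
  Bipartite = Σ[ colour ∈ (Vertex → Bool) ] ∀ {u v} → u ~ v → colour u ≢ colour v

{-# OPTIONS --safe #-}
-- Let N be the incidence matrix between a v-set and all of its nonempty subsets. Each point lies in
-- 2^(v-1) subsets and each pair of points in 2^(v-2), so N Nᵀ = 2^(v-2) (I + J) has just the eigenvalues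
-- 2^(v-2) and 2^(v-2) (v+1), and the incidence graph has the eigenvalues 0, ±√(2^(v-2)), ±√(2^(v-2) (v+1)).
-- The subsets have all the valencies 1, …, v. Choosing v = 2 + 2e with v + 1 = s² makes the eigenvalues the
-- integers 0, ±2^e, ±2^e s. Constructively, an arbitrary eigenvalue μ satisfies ∏ (μ - θ) = 0 over these
-- five θ, and as they are pairwise apart, cotransitivity separates μ from all of them but one.
module Submission where

open import Algebra.Bundles using (CommutativeMonoid; CommutativeRing)
import Algebra.Properties.CommutativeMonoid.Sum
import Algebra.Properties.Monoid.Sum
open import Data.Bool.Base using (Bool; true; false; if_then_else_; T)
open import Data.Bool.Properties using (T?; T-≡)
open import Data.Empty using (⊥-elim)
open import Data.Fin.Base using (Fin; zero; suc; toℕ; _↑ˡ_; _↑ʳ_; splitAt; join)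
open import Data.Fin.Properties as Fin using (splitAt-↑ˡ; splitAt-↑ʳ; join-splitAt; toℕ-injective)
open import Data.Integer.Base as ℤ using (ℤ; +_; -[1+_]; _≤_)
import Data.Integer.Properties as ℤₚ
open import Data.List.Base using (length; filter; tabulate)
open import Data.List.Membership.Propositional using (_∈_)
open import Data.List.Membership.Propositional.Properties using (∈-map⁺; ∈-allFin; ∈-deduplicate⁺)
import Data.List.Membership.Setoid.Properties as SetoidMembership
open import Data.List.Relation.Unary.Any using (index)
open import Data.Nat.Base as ℕ using (ℕ; zero; suc)
import Data.Nat.Properties as ℕₚ
open import Data.Nat.Solver using () renaming (module +-*-Solver to ℕ-Solver)
open import Data.Product.Base using (∃-syntax; Σ-syntax; _×_; _,_)
open import Data.Rational.Base as ℚ using (ℚ; 0ℚ; 1ℚ; ½; ∣_∣)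
import Data.Rational.Properties as ℚₚ
open import Data.Rational.Solver using () renaming (module +-*-Solver to ℚ-Solver)
open import Data.Sum.Base using (_⊎_; inj₁; inj₂)
open import Data.Vec.Functional using (Vector; []; _∷_; _++_; head; tail; take; drop; map; replicate; foldr)
open import Data.Vec.Functional.Properties using (lookup-++ˡ; lookup-++ʳ)
open import Function.Base using (_∘_)
open import Function.Bundles using (Equivalence)
open import Level as Level using (0ℓ; _⊔_)
open import Relation.Binary.Construct.Closure.ReflexiveTransitive as Star using (Star; _◅_; _◅◅_; reverse)
open import Relation.Binary.Core using (Rel; REL)
open import Relation.Binary.PropositionalEquality as ≡ using (_≡_; _≢_)
open import Relation.Nullary.Decidable.Core using (does; yes; no)
open import Relation.Nullary.Negation using (contradiction)
open import Relation.Unary using (Pred; Decidable)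

-- Sums over the nonempty subsets of a finite set

-- Classically one would ask whether μ vanishes and whether the point part of an eigenvector sums to
-- zero. Neither question can be decided for Cauchy reals, so the cases are multiplied together
-- instead: each factor of the annihilating product disposes of one of them, and nothing is divided
-- until apartness from 0 is available. The two square conditions also serve the constructive
-- setting. An even v makes 2^(v-2) a square and v + 1 = s² removes the other root, so all five
-- eigenvalues are constant rational sequences and their mutual apartness is an inequality between
-- rationals. The algebra is carried out over an abstract commutative ring, with apartness added
-- where needed, and is specialised to ℝ only at the end; this keeps Cauchy sequences from being
-- unfolded during the calculations.

#nonemptySubsets : ℕ → ℕ
#nonemptySubsets zero    = 0
#nonemptySubsets (suc n) = suc (#nonemptySubsets n ℕ.+ #nonemptySubsets n)

-- The order is {0}, then the nonempty sets T avoiding 0, then the sets T ∪ {0}. Leaving out the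
-- empty set keeps every block attached to some point, as connectedness requires. Since {0} comes
-- first, the two later parts begin with {1} and {0,1} when there are at least two points, which is
-- where `kernelVector` has its nonzero entries.
nonemptySubset : ∀ n → Vector (Vector Bool n) (#nonemptySubsets n)
nonemptySubset zero    = []
nonemptySubset (suc n) =
  (true ∷ replicate n false) ∷ (map (false ∷_) (nonemptySubset n) ++ map (true ∷_) (nonemptySubset n))

module SplitSum {c ℓ} (M : CommutativeMonoid c ℓ) where

  open CommutativeMonoid M renaming
    (_∙_ to _+_; ∙-cong to +-cong; ∙-congˡ to +-congˡ; identityˡ to +-identityˡ; assoc to +-assoc)
  open import Algebra.Properties.CommutativeMonoid.Sum M

  sum-take-drop : ∀ m {n} (f : Vector Carrier (m ℕ.+ n)) → sum f ≈ sum (take m f) + sum (drop m f)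
  sum-take-drop zero    f = sym (+-identityˡ _)
  sum-take-drop (suc m) f = trans (+-congˡ (sum-take-drop m (tail f))) (sym (+-assoc _ _ _))

  sum-map-++ : ∀ {b} {B : Set b} (f : B → Carrier) {m n} (xs : Vector B m) (ys : Vector B n) →
               sum (map f (xs ++ ys)) ≈ sum (map f xs) + sum (map f ys)
  sum-map-++ f {m} {n} xs ys = trans (sum-take-drop m (map f (xs ++ ys)))
    (+-cong (sum-cong-≋ (λ i → reflexive (≡.cong f (lookup-++ˡ xs ys i))))
            (sum-cong-≋ (λ i → reflexive (≡.cong f (lookup-++ʳ xs ys i)))))

  sum-nonemptySubset : ∀ n (f : Vector Bool (suc n) → Carrier) →
    sum (map f (nonemptySubset (suc n)))
      ≈ f (true ∷ replicate n false)
        + (sum (λ i → f (false ∷ nonemptySubset n i)) + sum (λ i → f (true ∷ nonemptySubset n i)))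
  sum-nonemptySubset n f =
    +-congˡ (sum-map-++ f (map (false ∷_) (nonemptySubset n)) (map (true ∷_) (nonemptySubset n)))

module SubsetSums {c ℓ} (R : CommutativeRing c ℓ) where

  open CommutativeRing R
  open import Algebra.Properties.Semiring.Sum semiring
  open import Algebra.Properties.Semiring.Exp semiring using (_^_)
  open import Algebra.Solver.Ring.NaturalCoefficients.Default commutativeSemiring
    using (solve; _:=_; _:+_; _:*_; con)
  open import Relation.Binary.Reasoning.Setoid setoid
  open SplitSum +-commutativeMonoid

  2# : Carrier
  2# = 1# + 1#

  ⟦_⟧ : Bool → Carrier
  ⟦ b ⟧ = if b then 1# else 0#

  -- The entry of Nᵀ x at the block T.
  total : ∀ {n} → Vector Carrier n → Vector Bool n → Carrier
  total x T = sum (λ q → ⟦ T q ⟧ * x q)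

  2^suc* : ∀ n z → 2# ^ suc n * z ≈ 2# ^ n * z + 2# ^ n * z
  2^suc* n z = begin
    2# * 2# ^ n * z               ≈⟨ *-assoc _ _ _ ⟩
    2# * (2# ^ n * z)             ≈⟨ distribʳ _ _ _ ⟩
    1# * (2# ^ n * z) + 1# * (2# ^ n * z) ≈⟨ +-cong (*-identityˡ _) (*-identityˡ _) ⟩
    2# ^ n * z + 2# ^ n * z       ∎

  sum≈0 : ∀ {n} (f : Vector Carrier n) → (∀ i → f i ≈ 0#) → sum f ≈ 0#
  sum≈0 {n} f f≈0 = trans (sum-cong-≋ f≈0) (sum-replicate-zero n)

  total-true : ∀ {n} (x : Vector Carrier (suc n)) T → total x (true ∷ T) ≈ head x + total (tail x) T
  total-true x T = +-congʳ (*-identityˡ _)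

  total-false : ∀ {n} (x : Vector Carrier (suc n)) T → total x (false ∷ T) ≈ total (tail x) T
  total-false x T = trans (+-congʳ (zeroˡ _)) (+-identityˡ _)

  total-singleton : ∀ {n} (x : Vector Carrier (suc n)) → total x (true ∷ replicate n false) ≈ head x
  total-singleton {n} x = trans (total-true x (replicate n false))
    (trans (+-congˡ (sum≈0 (λ q → 0# * x (suc q)) (λ q → zeroˡ _))) (+-identityʳ _))

  -- The separate z stands for the empty set; counting it turns 2^n - 1 into 2^n, so the induction
  -- is plain doubling.
  sum-const-nonemptySubset : ∀ n z → z + sum {#nonemptySubsets n} (λ _ → z) ≈ 2# ^ n * z
  sum-const-nonemptySubset zero    z = trans (+-identityʳ z) (sym (*-identityˡ z))
  sum-const-nonemptySubset (suc n) z = begin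
    z + sum (λ (_ : Fin (#nonemptySubsets (suc n))) → z)
      ≈⟨ +-congˡ (+-congˡ (sum-take-drop k (λ _ → z))) ⟩
    z + (z + (s + s))
      ≈⟨ solve 2 (λ z s → z :+ (z :+ (s :+ s)) := (z :+ s) :+ (z :+ s)) refl z s ⟩
    (z + s) + (z + s)
      ≈⟨ +-cong (sum-const-nonemptySubset n z) (sum-const-nonemptySubset n z) ⟩
    2# ^ n * z + 2# ^ n * z
      ≈⟨ 2^suc* n z ⟨
    2# ^ suc n * z ∎
    where
    k = #nonemptySubsets n
    s = sum {k} (λ _ → z)

  -- With z the value at a new point 0, this runs over all sets containing 0; the separate z is the
  -- term of {0} itself.
  sum-+total : ∀ n z (x : Vector Carrier n) →
    z + sum (λ i → z + total x (nonemptySubset n i)) ≈ 2# ^ n * z + sum (map (total x) (nonemptySubset n))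
  sum-+total n z x = begin
    z + sum (λ i → z + total x (nonemptySubset n i))
      ≈⟨ +-congˡ (∑-distrib-+ (λ _ → z) (map (total x) (nonemptySubset n))) ⟩
    z + (sum {#nonemptySubsets n} (λ _ → z) + sum (map (total x) (nonemptySubset n)))
      ≈⟨ +-assoc _ _ _ ⟨
    (z + sum {#nonemptySubsets n} (λ _ → z)) + sum (map (total x) (nonemptySubset n))
      ≈⟨ +-congʳ (sum-const-nonemptySubset n z) ⟩
    2# ^ n * z + sum (map (total x) (nonemptySubset n)) ∎

  -- Double counting: each of the n + 1 points lies in 2^n of the subsets. The sets containing 0
  -- yield the multiple of `head x` and one copy of the sum over the tail, the sets avoiding 0
  -- another copy.
  sum-total : ∀ n (x : Vector Carrier (suc n)) → sum (map (total x) (nonemptySubset (suc n))) ≈ 2# ^ n * sum x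
  sum-total n x = begin
    sum (map (total x) (nonemptySubset (suc n)))
      ≈⟨ sum-nonemptySubset n (total x) ⟩
    total x (true ∷ replicate n false)
      + (sum (λ i → total x (false ∷ nonemptySubset n i)) + sum (λ i → total x (true ∷ nonemptySubset n i)))
      ≈⟨ +-cong (total-singleton x)
           (+-cong (sum-cong-≋ (λ i → total-false x (nonemptySubset n i)))
                   (sum-cong-≋ (λ i → total-true x (nonemptySubset n i)))) ⟩
    head x + (t + sum (λ i → head x + total (tail x) (nonemptySubset n i)))
      ≈⟨ solve 3 (λ a b c → a :+ (b :+ c) := (a :+ c) :+ b) refl _ _ _ ⟩
    (head x + sum (λ i → head x + total (tail x) (nonemptySubset n i))) + t
      ≈⟨ +-congʳ (sum-+total n (head x) (tail x)) ⟩
    (2# ^ n * head x + t) + t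
      ≈⟨ +-assoc _ _ _ ⟩
    2# ^ n * head x + (t + t)
      ≈⟨ +-congˡ (doubled n (tail x)) ⟩
    2# ^ n * head x + 2# ^ n * sum (tail x)
      ≈⟨ distribˡ _ _ _ ⟨
    2# ^ n * sum x ∎
    where
    t = sum (map (total (tail x)) (nonemptySubset n))
    -- The tail may have no points, where the exponent n - 1 would make no sense; doubling the sum
    -- raises it to n.
    doubled : ∀ n (x : Vector Carrier n) →
      sum (map (total x) (nonemptySubset n)) + sum (map (total x) (nonemptySubset n)) ≈ 2# ^ n * sum x
    doubled zero    x = trans (+-identityˡ _) (sym (zeroʳ _))
    doubled (suc n) x = trans (+-cong (sum-total n x) (sum-total n x)) (sym (2^suc* n (sum x)))

  sum-containing : ∀ n p z → sum (λ i → ⟦ nonemptySubset (suc n) i p ⟧ * z) ≈ 2# ^ n * z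
  sum-containing n p z = trans (sum-nonemptySubset n (λ T → ⟦ T p ⟧ * z)) (step n p)
    where
    step : ∀ n p → ⟦ (true ∷ replicate n false) p ⟧ * z
             + (sum (λ i → ⟦ (false ∷ nonemptySubset n i) p ⟧ * z)
                + sum (λ i → ⟦ (true ∷ nonemptySubset n i) p ⟧ * z)) ≈ 2# ^ n * z
    step n zero = trans
      (+-cong (*-identityˡ z)
        (trans (+-cong (sum≈0 {#nonemptySubsets n} (λ _ → 0# * z) (λ _ → zeroˡ z))
                       (sum-cong-≋ {#nonemptySubsets n} (λ _ → *-identityˡ z)))
               (+-identityˡ _)))
      (sum-const-nonemptySubset n z)
    step (suc n) (suc p) = trans (+-congʳ (zeroˡ z)) (trans (+-identityˡ _)
      (trans (+-cong (sum-containing n p z) (sum-containing n p z)) (sym (2^suc* n z))))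

  -- This is N Nᵀ = 2^n (I + J) applied to x. For p = 0 only the sets containing 0 contribute. For a
  -- later p both halves contribute the same sum over the tail, and the half containing 0 adds
  -- `head x` once for each of the 2^n sets T with p in T.
  sum-total-containing : ∀ n (x : Vector Carrier (suc (suc n))) p →
    sum (λ i → ⟦ nonemptySubset (suc (suc n)) i p ⟧ * total x (nonemptySubset (suc (suc n)) i))
      ≈ 2# ^ n * (x p + sum x)
  sum-total-containing n x p =
    trans (sum-nonemptySubset (suc n) (λ T → ⟦ T p ⟧ * total x T)) (step n x p)
    where
    step : ∀ n (x : Vector Carrier (suc (suc n))) p →
      ⟦ (true ∷ replicate (suc n) false) p ⟧ * total x (true ∷ replicate (suc n) false)
        + (sum (λ i → ⟦ (false ∷ nonemptySubset (suc n) i) p ⟧ * total x (false ∷ nonemptySubset (suc n) i))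
           + sum (λ i → ⟦ (true ∷ nonemptySubset (suc n) i) p ⟧ * total x (true ∷ nonemptySubset (suc n) i)))
        ≈ 2# ^ n * (x p + sum x)
    step n x zero = begin
      1# * total x (true ∷ replicate (suc n) false)
        + (sum (λ i → 0# * total x (false ∷ nonemptySubset (suc n) i))
           + sum (λ i → 1# * total x (true ∷ nonemptySubset (suc n) i)))
        ≈⟨ +-cong (trans (*-identityˡ _) (total-singleton x))
             (+-cong (sum≈0 (λ i → 0# * total x (false ∷ nonemptySubset (suc n) i)) (λ _ → zeroˡ _))
                     (sum-cong-≋ (λ i → trans (*-identityˡ _) (total-true x (nonemptySubset (suc n) i))))) ⟩
      head x + (0# + sum (λ i → head x + total (tail x) (nonemptySubset (suc n) i)))
        ≈⟨ +-congˡ (+-identityˡ _) ⟩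
      head x + sum (λ i → head x + total (tail x) (nonemptySubset (suc n) i))
        ≈⟨ sum-+total (suc n) (head x) (tail x) ⟩
      2# ^ suc n * head x + sum (map (total (tail x)) (nonemptySubset (suc n)))
        ≈⟨ +-cong (2^suc* n _) (sum-total n (tail x)) ⟩
      (2# ^ n * head x + 2# ^ n * head x) + 2# ^ n * sum (tail x)
        ≈⟨ solve 3 (λ c a b → (c :* a :+ c :* a) :+ c :* b := c :* (a :+ (a :+ b))) refl _ _ _ ⟩
      2# ^ n * (head x + sum x) ∎
    step n x (suc p) = begin
      0# * total x (true ∷ replicate (suc n) false)
        + (sum (λ i → w i * total x (false ∷ nonemptySubset (suc n) i))
           + sum (λ i → w i * total x (true ∷ nonemptySubset (suc n) i)))
        ≈⟨ trans (+-congʳ (zeroˡ _)) (+-identityˡ _) ⟩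
      sum (λ i → w i * total x (false ∷ nonemptySubset (suc n) i))
        + sum (λ i → w i * total x (true ∷ nonemptySubset (suc n) i))
        ≈⟨ +-cong (sum-cong-≋ (λ i → *-congˡ {w i} (total-false x (nonemptySubset (suc n) i))))
             (trans (sum-cong-≋ (λ i →
                      trans (*-congˡ {w i} (total-true x (nonemptySubset (suc n) i))) (distribˡ (w i) _ _)))
                    (∑-distrib-+ (λ i → w i * head x) (λ i → w i * total (tail x) (nonemptySubset (suc n) i)))) ⟩
      u + (sum (λ i → w i * head x) + u)
        ≈⟨ +-congˡ (+-congʳ (sum-containing n p (head x))) ⟩
      u + (2# ^ n * head x + u)
        ≈⟨ solve 2 (λ u v → u :+ (v :+ u) := v :+ (u :+ u)) refl _ _ ⟩
      2# ^ n * head x + (u + u)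
        ≈⟨ +-congˡ (doubled n (tail x) p) ⟩
      2# ^ n * head x + 2# ^ n * (x (suc p) + sum (tail x))
        ≈⟨ solve 4 (λ c a b s → c :* a :+ c :* (b :+ s) := c :* (b :+ (a :+ s))) refl _ _ _ _ ⟩
      2# ^ n * (x (suc p) + sum x) ∎
      where
      w = λ i → ⟦ nonemptySubset (suc n) i p ⟧
      u = sum (λ i → w i * total (tail x) (nonemptySubset (suc n) i))
      -- Again doubling avoids the exponent n - 1; a tail of one point, with its single subset, is
      -- the base case.
      doubled : ∀ n (x : Vector Carrier (suc n)) p →
        let u = sum (λ i → ⟦ nonemptySubset (suc n) i p ⟧ * total x (nonemptySubset (suc n) i))
        in u + u ≈ 2# ^ n * (x p + sum x)
      doubled zero x zero =
        trans (+-cong lemma lemma) (trans (+-congˡ (sym (+-identityʳ _))) (sym (*-identityˡ _)))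
        where
        lemma : 1# * (1# * head x + 0#) + 0# ≈ head x
        lemma = trans (+-identityʳ _) (trans (*-identityˡ _) (trans (+-identityʳ _) (*-identityˡ _)))
      doubled (suc n) x p =
        trans (+-cong (sum-total-containing n x p) (sum-total-containing n x p)) (sym (2^suc* n _))

-- Spectra of incidence graphs

↑-elim : ∀ {ℓ} n {k} (P : Fin (n ℕ.+ k) → Set ℓ) →
         (∀ p → P (p ↑ˡ k)) → (∀ b → P (n ↑ʳ b)) → ∀ i → P i
↑-elim n {k} P left right i = ≡.subst P (join-splitAt n k i) (onSum (splitAt n i))
  where
  onSum : ∀ s → P (join n k s)
  onSum (inj₁ p) = left p
  onSum (inj₂ b) = right b

incident : ∀ {n k} → Vector (Vector Bool n) k → Fin n ⊎ Fin k → Fin n ⊎ Fin k → Bool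
incident B (inj₁ p) (inj₂ b) = B b p
incident B (inj₂ b) (inj₁ p) = B b p
incident B (inj₁ _) (inj₁ _) = false
incident B (inj₂ _) (inj₂ _) = false

adjacent : ∀ {n k} → Vector (Vector Bool n) k → Fin (n ℕ.+ k) → Fin (n ℕ.+ k) → Bool
adjacent {n} B u v = incident B (splitAt n u) (splitAt n v)

adjacent-pp : ∀ {n k} (B : Vector (Vector Bool n) k) p q → adjacent B (p ↑ˡ k) (q ↑ˡ k) ≡ false
adjacent-pp {n} {k} B p q = ≡.cong₂ (incident B) (splitAt-↑ˡ n p k) (splitAt-↑ˡ n q k)

adjacent-pb : ∀ {n k} (B : Vector (Vector Bool n) k) p b → adjacent B (p ↑ˡ k) (n ↑ʳ b) ≡ B b p
adjacent-pb {n} {k} B p b = ≡.cong₂ (incident B) (splitAt-↑ˡ n p k) (splitAt-↑ʳ n k b)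

adjacent-bp : ∀ {n k} (B : Vector (Vector Bool n) k) b p → adjacent B (n ↑ʳ b) (p ↑ˡ k) ≡ B b p
adjacent-bp {n} {k} B b p = ≡.cong₂ (incident B) (splitAt-↑ʳ n k b) (splitAt-↑ˡ n p k)

adjacent-bb : ∀ {n k} (B : Vector (Vector Bool n) k) b d → adjacent B (n ↑ʳ b) (n ↑ʳ d) ≡ false
adjacent-bb {n} {k} B b d = ≡.cong₂ (incident B) (splitAt-↑ʳ n k b) (splitAt-↑ʳ n k d)

module IncidenceSpectrum {r ℓ} (R : CommutativeRing r ℓ) where

  open CommutativeRing R
  open import Algebra.Properties.Ring ring using ([y-z]x≈yx-zx)
  open import Algebra.Properties.AbelianGroup +-abelianGroup using (⁻¹-involutive; xyx⁻¹≈y)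
  open import Algebra.Properties.CommutativeSemigroup *-commutativeSemigroup using (x∙yz≈y∙xz)
  open import Algebra.Properties.Semiring.Sum semiring
  open import Relation.Binary.Reasoning.Setoid setoid
  open SplitSum +-commutativeMonoid
  open SubsetSums R using (⟦_⟧; total; sum≈0)

  -- The value of ∏ (X - θ) at μ, with w as innermost factor so that the product can act on a
  -- coordinate of an eigenvector.
  rootProduct : ∀ {m} → Vector Carrier m → Carrier → Carrier → Carrier
  rootProduct θ μ w = foldr (λ t z → (μ - t) * z) w θ

  ±roots : Carrier → Carrier → Vector Carrier 5
  ±roots a b = 0# ∷ a ∷ - a ∷ b ∷ - b ∷ []

  difference-of-squares : ∀ μ a w → (μ - a) * ((μ - - a) * w) ≈ (μ * μ - a * a) * w
  difference-of-squares μ a w = trans (sym (*-assoc _ _ w)) (*-congʳ (begin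
    (μ - a) * (μ - - a)                  ≈⟨ *-congˡ (+-congˡ (⁻¹-involutive a)) ⟩
    (μ - a) * (μ + a)                    ≈⟨ distribˡ _ _ _ ⟩
    (μ - a) * μ + (μ - a) * a            ≈⟨ +-cong ([y-z]x≈yx-zx μ μ a) ([y-z]x≈yx-zx a μ a) ⟩
    (μ * μ - a * μ) + (μ * a - a * a)    ≈⟨ +-assoc _ _ _ ⟩
    μ * μ + (- (a * μ) + (μ * a - a * a)) ≈⟨ +-congˡ (+-assoc _ _ _) ⟨
    μ * μ + ((- (a * μ) + μ * a) - a * a) ≈⟨ +-congˡ (+-congʳ (+-congˡ (*-comm μ a))) ⟩
    μ * μ + ((- (a * μ) + a * μ) - a * a) ≈⟨ +-congˡ (+-congʳ (-‿inverseˡ _)) ⟩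
    μ * μ + (0# - a * a)                 ≈⟨ +-congˡ (+-identityˡ _) ⟩
    μ * μ - a * a                        ∎))

  rootProduct-±roots : ∀ μ a b w →
    rootProduct (±roots a b) μ w ≈ μ * ((μ * μ - a * a) * ((μ * μ - b * b) * w))
  rootProduct-±roots μ a b w = *-cong
    (trans (+-congˡ (trans (sym (+-identityˡ _)) (-‿inverseʳ 0#))) (+-identityʳ μ))
    (trans (difference-of-squares μ a _) (*-congˡ (difference-of-squares μ b w)))

  module _ {n k} (B : Vector (Vector Bool n) k) where

    total-homo-* : ∀ z (x : Vector Carrier n) T → z * total x T ≈ total (λ q → z * x q) T
    total-homo-* z x T = trans (*-distribˡ-sum z (λ q → ⟦ T q ⟧ * x q))
      (sum-cong-≋ (λ q → x∙yz≈y∙xz z ⟦ T q ⟧ (x q)))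

    total-cong : ∀ {x y : Vector Carrier n} → (∀ q → x q ≈ y q) → ∀ T → total x T ≈ total y T
    total-cong x≈y T = sum-cong-≋ (λ q → *-congˡ {⟦ T q ⟧} (x≈y q))

    _·_ : Fin (n ℕ.+ k) → Vector Carrier (n ℕ.+ k) → Carrier
    u · v = sum (λ w → ⟦ adjacent B u w ⟧ * v w)

    point-· : ∀ p v → (p ↑ˡ k) · v ≈ sum (λ b → ⟦ B b p ⟧ * v (n ↑ʳ b))
    point-· p v = begin
      (p ↑ˡ k) · v
        ≈⟨ sum-take-drop n (λ w → ⟦ adjacent B (p ↑ˡ k) w ⟧ * v w) ⟩
      sum (λ q → ⟦ adjacent B (p ↑ˡ k) (q ↑ˡ k) ⟧ * v (q ↑ˡ k))
        + sum (λ b → ⟦ adjacent B (p ↑ˡ k) (n ↑ʳ b) ⟧ * v (n ↑ʳ b))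
        ≈⟨ +-cong (sum≈0 _ (λ q → trans (*-congʳ (reflexive (≡.cong ⟦_⟧ (adjacent-pp B p q)))) (zeroˡ _)))
             (sum-cong-≋ (λ b → *-congʳ {v (n ↑ʳ b)} (reflexive (≡.cong ⟦_⟧ (adjacent-pb B p b))))) ⟩
      0# + sum (λ b → ⟦ B b p ⟧ * v (n ↑ʳ b))
        ≈⟨ +-identityˡ _ ⟩
      sum (λ b → ⟦ B b p ⟧ * v (n ↑ʳ b)) ∎

    block-· : ∀ b v → (n ↑ʳ b) · v ≈ total (take n v) (B b)
    block-· b v = begin
      (n ↑ʳ b) · v
        ≈⟨ sum-take-drop n (λ w → ⟦ adjacent B (n ↑ʳ b) w ⟧ * v w) ⟩
      sum (λ q → ⟦ adjacent B (n ↑ʳ b) (q ↑ˡ k) ⟧ * v (q ↑ˡ k))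
        + sum (λ d → ⟦ adjacent B (n ↑ʳ b) (n ↑ʳ d) ⟧ * v (n ↑ʳ d))
        ≈⟨ +-cong
             (sum-cong-≋ (λ q → *-congʳ {v (q ↑ˡ k)} (reflexive (≡.cong ⟦_⟧ (adjacent-bp B b q)))))
             (sum≈0 _ (λ d → trans (*-congʳ (reflexive (≡.cong ⟦_⟧ (adjacent-bb B b d)))) (zeroˡ _))) ⟩
      total (take n v) (B b) + 0#
        ≈⟨ +-identityʳ _ ⟩
      total (take n v) (B b) ∎

    -- The adjacency matrix sends (x, y) to (N y, Nᵀ x). With x = 0 the block rows vanish and the
    -- point rows are N y.
    kernel-eigenvector : ∀ (y : Vector Carrier k) → (∀ p → sum (λ b → ⟦ B b p ⟧ * y b) ≈ 0#) →
      let v = replicate n 0# ++ y in ∀ u → u · v ≈ 0# * v u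
    kernel-eigenvector y Ny≈0 = ↑-elim n (λ u → u · v ≈ 0# * v u)
      (λ p → trans (point-· p v)
        (trans (sum-cong-≋ (λ b → *-congˡ {⟦ B b p ⟧} (reflexive (lookup-++ʳ x y b))))
          (trans (Ny≈0 p) (sym (zeroˡ _)))))
      (λ b → trans (block-· b v)
        (trans (sum≈0 _ (λ q → trans (*-congˡ {⟦ B b q ⟧} (reflexive (lookup-++ˡ x y q))) (zeroʳ _)))
          (sym (zeroˡ _))))
      where
      x = replicate n 0#
      v = x ++ y

    module _ (c : Carrier)
      (gram : ∀ x p → sum (λ b → ⟦ B b p ⟧ * total x (B b)) ≈ c * (x p + sum x)) where

      -- The vector (μ x, Nᵀ x) is mapped to (N Nᵀ x, μ Nᵀ x), so N Nᵀ x = μ² x suffices, and the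
      -- same x serves both μ and -μ.
      gram-eigenvector : ∀ μ (x : Vector Carrier n) → (∀ p → c * (x p + sum x) ≈ μ * (μ * x p)) →
        let v = (λ p → μ * x p) ++ (λ b → total x (B b)) in ∀ u → u · v ≈ μ * v u
      gram-eigenvector μ x gram-x = ↑-elim n (λ u → u · v ≈ μ * v u)
        (λ p → begin
          (p ↑ˡ k) · v                            ≈⟨ point-· p v ⟩
          sum (λ b → ⟦ B b p ⟧ * v (n ↑ʳ b))      ≈⟨ sum-cong-≋ (λ b →
                                                       *-congˡ {⟦ B b p ⟧} (reflexive (lookup-++ʳ y z b))) ⟩
          sum (λ b → ⟦ B b p ⟧ * total x (B b))   ≈⟨ gram x p ⟩
          c * (x p + sum x)                       ≈⟨ gram-x p ⟩
          μ * (μ * x p)                           ≈⟨ *-congˡ (reflexive (lookup-++ˡ y z p)) ⟨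
          μ * v (p ↑ˡ k)                          ∎)
        (λ b → begin
          (n ↑ʳ b) · v                            ≈⟨ block-· b v ⟩
          total (take n v) (B b)                  ≈⟨ total-cong (λ q → reflexive (lookup-++ˡ y z q)) (B b) ⟩
          total (λ q → μ * x q) (B b)             ≈⟨ total-homo-* μ x (B b) ⟨
          μ * total x (B b)                       ≈⟨ *-congˡ (reflexive (lookup-++ʳ y z b)) ⟨
          μ * v (n ↑ʳ b)                          ∎)
        where
        y = λ p → μ * x p
        z = λ b → total x (B b)
        v = y ++ z

      -- Let x be the point part of v and σ its sum. Applying the matrix twice gives μ² x = c (x +
      -- σ) at each point; summed over the points, μ² σ = c N σ. Hence e σ = 0 and d x = c σ, so d e
      -- kills the point part. On a block, μ times the entry is a sum of entries of x, which
      -- accounts for the remaining factor μ.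
      eigenvector-annihilated : ∀ a b → a * a ≈ c → b * b ≈ c * (1# + sum {n} (λ _ → 1#)) →
        ∀ μ v → (∀ u → u · v ≈ μ * v u) → ∀ u → rootProduct (±roots a b) μ (v u) ≈ 0#
      eigenvector-annihilated a b aa≈c bb≈cN μ v Av≈μv u =
        trans (rootProduct-±roots μ a b (v u))
          (trans (*-congˡ (*-cong (+-congˡ (-‿cong aa≈c)) (*-congʳ (+-congˡ (-‿cong bb≈cN)))))
            (↑-elim n (λ u → μ * (d * (e * v u)) ≈ 0#)
              (λ p → trans (*-congˡ (de-point p)) (zeroʳ μ)) de-block u))
        where
        -- The number of points plus one: the eigenvalue of I + J on constant vectors.
        N = 1# + sum {n} (λ _ → 1#)
        d = μ * μ - c
        e = μ * μ - c * N
        x = take n v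
        σ = sum x

        μμx : ∀ p → μ * μ * x p ≈ c * (x p + σ)
        μμx p = begin
          μ * μ * x p                                ≈⟨ *-assoc _ _ _ ⟩
          μ * (μ * x p)                              ≈⟨ *-congˡ (Av≈μv (p ↑ˡ k)) ⟨
          μ * ((p ↑ˡ k) · v)                         ≈⟨ *-congˡ (point-· p v) ⟩
          μ * sum (λ b → ⟦ B b p ⟧ * v (n ↑ʳ b))     ≈⟨ *-distribˡ-sum μ (λ b → ⟦ B b p ⟧ * v (n ↑ʳ b)) ⟩
          sum (λ b → μ * (⟦ B b p ⟧ * v (n ↑ʳ b)))   ≈⟨ sum-cong-≋ (λ b → x∙yz≈y∙xz μ ⟦ B b p ⟧ (v (n ↑ʳ b))) ⟩
          sum (λ b → ⟦ B b p ⟧ * (μ * v (n ↑ʳ b)))   ≈⟨ sum-cong-≋ (λ b → *-congˡ {⟦ B b p ⟧}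
                                                          (trans (sym (Av≈μv (n ↑ʳ b))) (block-· b v))) ⟩
          sum (λ b → ⟦ B b p ⟧ * total x (B b))      ≈⟨ gram x p ⟩
          c * (x p + σ)                              ∎

        μμσ : μ * μ * σ ≈ c * N * σ
        μμσ = begin
          μ * μ * σ                        ≈⟨ *-distribˡ-sum (μ * μ) x ⟩
          sum (λ p → μ * μ * x p)          ≈⟨ sum-cong-≋ μμx ⟩
          sum (λ p → c * (x p + σ))        ≈⟨ *-distribˡ-sum c (λ p → x p + σ) ⟨
          c * sum (λ p → x p + σ)          ≈⟨ *-congˡ (∑-distrib-+ x (λ _ → σ)) ⟩
          c * (σ + sum {n} (λ _ → σ))      ≈⟨ *-congˡ (+-cong (*-identityˡ σ) (sum-cong-≋ {n} (λ _ → *-identityˡ σ))) ⟨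
          c * (1# * σ + sum {n} (λ _ → 1# * σ))
                                           ≈⟨ *-congˡ (+-congˡ (*-distribʳ-sum {n} σ (λ _ → 1#))) ⟨
          c * (1# * σ + sum {n} (λ _ → 1#) * σ)
                                           ≈⟨ *-congˡ (distribʳ σ 1# _) ⟨
          c * (N * σ)                      ≈⟨ *-assoc c N σ ⟨
          c * N * σ                        ∎

        eσ≈0 : e * σ ≈ 0#
        eσ≈0 = trans ([y-z]x≈yx-zx σ _ _) (trans (+-congʳ μμσ) (-‿inverseʳ _))

        dx : ∀ p → d * x p ≈ c * σ
        dx p = begin
          d * x p                       ≈⟨ [y-z]x≈yx-zx (x p) _ _ ⟩
          μ * μ * x p - c * x p         ≈⟨ +-congʳ (trans (μμx p) (distribˡ c _ _)) ⟩
          c * x p + c * σ - c * x p     ≈⟨ xyx⁻¹≈y _ _ ⟩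
          c * σ                         ∎

        de-point : ∀ p → d * (e * x p) ≈ 0#
        de-point p = begin
          d * (e * x p)  ≈⟨ x∙yz≈y∙xz d e (x p) ⟩
          e * (d * x p)  ≈⟨ *-congˡ (dx p) ⟩
          e * (c * σ)    ≈⟨ x∙yz≈y∙xz e c σ ⟩
          c * (e * σ)    ≈⟨ *-congˡ eσ≈0 ⟩
          c * 0#         ≈⟨ zeroʳ c ⟩
          0#             ∎

        de-block : ∀ b → μ * (d * (e * v (n ↑ʳ b))) ≈ 0#
        de-block b = begin
          μ * (d * (e * v (n ↑ʳ b)))            ≈⟨ x∙yz≈y∙xz μ d _ ⟩
          d * (μ * (e * v (n ↑ʳ b)))            ≈⟨ *-congˡ (x∙yz≈y∙xz μ e _) ⟩
          d * (e * (μ * v (n ↑ʳ b)))            ≈⟨ *-congˡ (*-congˡ (trans (sym (Av≈μv (n ↑ʳ b))) (block-· b v))) ⟩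
          d * (e * total x (B b))               ≈⟨ *-congˡ (total-homo-* e x (B b)) ⟩
          d * total (λ q → e * x q) (B b)       ≈⟨ total-homo-* d (λ q → e * x q) (B b) ⟩
          total (λ q → d * (e * x q)) (B b)     ≈⟨ sum≈0 _ (λ q → trans (*-congˡ {⟦ B b q ⟧} (de-point q)) (zeroʳ _)) ⟩
          0#                                    ∎

-- Commutative rings with apartness

record ApartnessRing r ℓ₁ ℓ₂ ℓ₃ : Set (Level.suc (r ⊔ ℓ₁ ⊔ ℓ₂ ⊔ ℓ₃)) where
  field
    commutativeRing : CommutativeRing r ℓ₁

  open CommutativeRing commutativeRing public hiding (zero)

  infix 4 _#_ _≐_

  field
    _#_            : Rel Carrier ℓ₂
    #-sym          : ∀ {x y} → x # y → y # x
    #-cotrans      : ∀ {x y} → x # y → ∀ z → z # x ⊎ z # y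
    x#y⇒x-y#0      : ∀ {x y} → x # y → x - y # 0#
    *-#0           : ∀ {x y} → x # 0# → y # 0# → x * y # 0#
    x#0∧xy≈0⇒y≈0   : ∀ {x y} → x # 0# → x * y ≈ 0# → y ≈ 0#
    -- x ≐ q says that x is the rational number q.
    _≐_            : REL Carrier ℚ ℓ₃
    ≐-0            : 0# ≐ 0ℚ
    ≐-1            : 1# ≐ 1ℚ
    ≐-+            : ∀ {x y p q} → x ≐ p → y ≐ q → x + y ≐ p ℚ.+ q
    ≐-*            : ∀ {x y p q} → x ≐ p → y ≐ q → x * y ≐ p ℚ.* q
    ≐-neg          : ∀ {x p} → x ≐ p → - x ≐ ℚ.- p
    ≐-#            : ∀ {x y p q} → x ≐ p → y ≐ q → p ≢ q → x # y

-- Roots of products of pairwise apart linear factors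

module ApartRoots {r ℓ₁ ℓ₂ ℓ₃} (A : ApartnessRing r ℓ₁ ℓ₂ ℓ₃) where

  open ApartnessRing A
  open import Algebra.Properties.Group +-group using (x∙y⁻¹≈ε⇒x≈y)
  open IncidenceSpectrum commutativeRing using (rootProduct; ±roots)

  -- Let θᵢ be the possible exception among the later roots. As θ₀ and θᵢ are apart, μ is apart from
  -- one of them: if from θ₀, the exception stays at θᵢ; if from θᵢ, it moves to θ₀.
  all-but-one-apart : ∀ {m} (θ : Vector Carrier (suc m)) → (∀ i j → i ≢ j → θ i # θ j) →
                      ∀ μ → ∃[ i ] ∀ j → j ≢ i → μ # θ j
  all-but-one-apart {zero}  θ θ-apart μ = zero , λ { zero 0≢0 → contradiction ≡.refl 0≢0 }
  all-but-one-apart {suc m} θ θ-apart μ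
    with all-but-one-apart (tail θ) (λ i j i≢j → θ-apart (suc i) (suc j) (i≢j ∘ Fin.suc-injective)) μ
  ... | i , apart with #-cotrans (θ-apart zero (suc i) (λ ())) μ
  ... | inj₁ μ#θ₀ = suc i , λ { zero _ → μ#θ₀ ; (suc j) j≢i → apart j (j≢i ∘ ≡.cong suc) }
  ... | inj₂ μ#θᵢ = zero , λ { zero 0≢0 → contradiction ≡.refl 0≢0 ; (suc j) _ → tail-apart j }
    where
    tail-apart : ∀ j → μ # θ (suc j)
    tail-apart j with j Fin.≟ i
    ... | yes ≡.refl = μ#θᵢ
    ... | no  j≢i    = apart j j≢i

  rootProduct-#0 : ∀ {m} (θ : Vector Carrier m) μ z → (∀ j → μ # θ j) → z # 0# → rootProduct θ μ z # 0#
  rootProduct-#0 {zero}  θ μ z apart z#0 = z#0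
  rootProduct-#0 {suc m} θ μ z apart z#0 =
    *-#0 (x#y⇒x-y#0 (apart zero)) (rootProduct-#0 (tail θ) μ z (apart ∘ suc) z#0)

  -- Factors apart from 0 can be cancelled: those before i one at a time, those after i together
  -- with z in one step, which leaves μ - θᵢ.
  rootProduct≈0⇒root : ∀ {m} (θ : Vector Carrier m) μ z i → (∀ j → j ≢ i → μ # θ j) → z # 0# →
                        rootProduct θ μ z ≈ 0# → μ ≈ θ i
  rootProduct≈0⇒root θ μ z zero apart z#0 product≈0 = x∙y⁻¹≈ε⇒x≈y μ (θ zero)
    (x#0∧xy≈0⇒y≈0 (rootProduct-#0 (tail θ) μ z (λ j → apart (suc j) (λ ())) z#0)
      (trans (*-comm _ _) product≈0))
  rootProduct≈0⇒root θ μ z (suc i) apart z#0 product≈0 =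
    rootProduct≈0⇒root (tail θ) μ z i (λ j j≢i → apart (suc j) (j≢i ∘ Fin.suc-injective)) z#0
      (x#0∧xy≈0⇒y≈0 (x#y⇒x-y#0 (apart zero (λ ()))) product≈0)

  rootProduct≈0⇒∃root : ∀ {m} (θ : Vector Carrier (suc m)) → (∀ i j → i ≢ j → θ i # θ j) →
                         ∀ μ z → z # 0# → rootProduct θ μ z ≈ 0# → ∃[ i ] μ ≈ θ i
  rootProduct≈0⇒∃root θ θ-apart μ z z#0 product≈0 =
    let i , apart = all-but-one-apart θ θ-apart μ in i , rootProduct≈0⇒root θ μ z i apart z#0 product≈0

  ∷-pairwise-# : ∀ {m} x (θ : Vector Carrier m) → (∀ i → x # θ i) →
                 (∀ i j → i ≢ j → θ i # θ j) → ∀ i j → i ≢ j → (x ∷ θ) i # (x ∷ θ) j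
  ∷-pairwise-# x θ x#θ θ-apart zero    zero    i≢j = contradiction ≡.refl i≢j
  ∷-pairwise-# x θ x#θ θ-apart zero    (suc j) i≢j = x#θ j
  ∷-pairwise-# x θ x#θ θ-apart (suc i) zero    i≢j = #-sym (x#θ i)
  ∷-pairwise-# x θ x#θ θ-apart (suc i) (suc j) i≢j = θ-apart i j (i≢j ∘ ≡.cong suc)

  -- The rational values are strictly ordered as -q < -p < 0 < p < q.
  ±roots-apart : ∀ {a b p q} → a ≐ p → b ≐ q → 0ℚ ℚ.< p → p ℚ.< q →
                 ∀ i j → i ≢ j → ±roots a b i # ±roots a b j
  ±roots-apart {a} {b} {p} {q} a≐p b≐q 0<p p<q =
    ∷-pairwise-# 0# (a ∷ - a ∷ b ∷ - b ∷ [])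
      (λ { zero                   → ≐-# ≐-0 a≐p (<⇒≢ 0<p)
         ; (suc zero)             → ≐-# ≐-0 -a≐-p (>⇒≢ -p<0)
         ; (suc (suc zero))       → ≐-# ≐-0 b≐q (<⇒≢ 0<q)
         ; (suc (suc (suc zero))) → ≐-# ≐-0 -b≐-q (>⇒≢ -q<0) })
    (∷-pairwise-# a (- a ∷ b ∷ - b ∷ [])
      (λ { zero             → ≐-# a≐p -a≐-p (>⇒≢ (ℚₚ.<-trans -p<0 0<p))
         ; (suc zero)       → ≐-# a≐p b≐q (<⇒≢ p<q)
         ; (suc (suc zero)) → ≐-# a≐p -b≐-q (>⇒≢ (ℚₚ.<-trans -q<0 0<p)) })
    (∷-pairwise-# (- a) (b ∷ - b ∷ [])
      (λ { zero       → ≐-# -a≐-p b≐q (<⇒≢ (ℚₚ.<-trans -p<0 0<q))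
         ; (suc zero) → ≐-# -a≐-p -b≐-q (>⇒≢ (ℚₚ.neg-antimono-< p<q)) })
    (∷-pairwise-# b (- b ∷ [])
      (λ { zero → ≐-# b≐q -b≐-q (>⇒≢ (ℚₚ.<-trans -q<0 0<q)) })
    (∷-pairwise-# (- b) [] (λ ()) (λ ())))))
    where
    <⇒≢ : ∀ {r s} → r ℚ.< s → r ≢ s
    <⇒≢ r<s ≡.refl = ℚₚ.<-irrefl ≡.refl r<s
    >⇒≢ : ∀ {r s} → s ℚ.< r → r ≢ s
    >⇒≢ s<r ≡.refl = ℚₚ.<-irrefl ≡.refl s<r
    0<q = ℚₚ.<-trans 0<p p<q
    -p<0 = ℚₚ.neg-antimono-< 0<p
    -q<0 = ℚₚ.neg-antimono-< 0<q
    -a≐-p = ≐-neg a≐p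
    -b≐-q = ≐-neg b≐q

-- The five eigenvalues of the graph of points and nonempty subsets

module SubsetSpectrum {r ℓ₁ ℓ₂ ℓ₃} (F : ApartnessRing r ℓ₁ ℓ₂ ℓ₃) where

  open ApartnessRing F
  open import Algebra.Properties.Ring ring using (-‿distribˡ-*; -‿distribʳ-*; -‿involutive)
  open import Algebra.Properties.CommutativeSemigroup *-commutativeSemigroup using (interchange)
  open import Algebra.Properties.Semiring.Exp semiring using (_^_; ^-homo-*)
  open import Algebra.Properties.Semiring.Mult semiring using (×1-homo-*; ×-congˡ) renaming (_×_ to _×#_)
  open import Algebra.Properties.Semiring.Sum semiring
  open import Relation.Binary.Reasoning.Setoid setoid
  open SplitSum +-commutativeMonoid
  open SubsetSums commutativeRing using (⟦_⟧; total; 2#; sum≈0; sum-total-containing)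
  open IncidenceSpectrum commutativeRing
  open ApartRoots F using (±roots-apart; rootProduct≈0⇒∃root)

  1#0 : 1# # 0#
  1#0 = ≐-# ≐-1 ≐-0 (λ ())

  2^-rational : ∀ e → ∃[ q ] 0ℚ ℚ.< q × 2# ^ e ≐ q
  2^-rational zero    = 1ℚ , ℚₚ.positive⁻¹ 1ℚ , ≐-1
  2^-rational (suc e) = let q , 0<q , 2^e≐q = 2^-rational e in
    (1ℚ ℚ.+ 1ℚ) ℚ.* q
    , ℚₚ.positive⁻¹ ((1ℚ ℚ.+ 1ℚ) ℚ.* q) {{ℚₚ.pos*pos⇒pos (1ℚ ℚ.+ 1ℚ) q {{ℚ.positive 0<q}}}}
    , ≐-* (≐-+ ≐-1 ≐-1) 2^e≐q

  ×1-rational : ∀ k → ∃[ q ] 0ℚ ℚ.≤ q × k ×# 1# ≐ q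
  ×1-rational zero    = 0ℚ , ℚₚ.≤-refl , ≐-0
  ×1-rational (suc k) = let q , 0≤q , k≐q = ×1-rational k in
    1ℚ ℚ.+ q , ℚₚ.+-mono-≤ {0ℚ} {1ℚ} {0ℚ} {q} (ℚₚ.<⇒≤ (ℚₚ.positive⁻¹ 1ℚ)) 0≤q , ≐-+ ≐-1 k≐q

  HasEigenvalue : ∀ {m} → (Fin m → Fin m → Carrier) → Carrier → Set _
  HasEigenvalue {m} A μ =
    Σ[ v ∈ Vector Carrier m ] (∃[ i ] v i # 0#) × (∀ i → sum (λ j → A i j * v j) ≈ μ * v i)

  subsetAdjacency : ∀ n → let m = n ℕ.+ #nonemptySubsets n in Fin m → Fin m → Carrier
  subsetAdjacency n u w = ⟦ adjacent (nonemptySubset n) u w ⟧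

  neg*neg : ∀ a → - a * - a ≈ a * a
  neg*neg a = begin
    - a * - a      ≈⟨ -‿distribˡ-* a (- a) ⟨
    - (a * - a)    ≈⟨ -‿cong (-‿distribʳ-* a a) ⟨
    - - (a * a)    ≈⟨ -‿involutive (a * a) ⟩
    a * a          ∎

  sum-singleton : ∀ {m} (f : Vector Carrier (suc m)) z → (∀ i → f (suc i) ≈ 0#) → f zero ≈ z → sum f ≈ z
  sum-singleton f z rest≈0 f₀≈z = trans (+-cong f₀≈z (sum≈0 (λ i → f (suc i)) rest≈0)) (+-identityʳ z)

  module _ (n : ℕ) where

    private
      v : ℕ
      v = suc (suc n)
      B : Vector (Vector Bool v) (#nonemptySubsets v)
      B = nonemptySubset v

    -- The relation {0} + {1} - {0,1} among the rows of the incidence matrix.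
    kernelVector : Vector Carrier (#nonemptySubsets v)
    kernelVector = 1# ∷ ((1# ∷ replicate k 0#) ++ (- 1# ∷ replicate k 0#))
      where k = #nonemptySubsets n ℕ.+ #nonemptySubsets n

    kernelVector-kernel : ∀ p → sum (λ b → ⟦ B b p ⟧ * kernelVector b) ≈ 0#
    kernelVector-kernel p = begin
      ⟦ single₀ p ⟧ * 1# + sum (λ b → ⟦ (without ++ with₀) b p ⟧ * (y ++ z) b)
        ≈⟨ +-cong (*-identityʳ _) (sum-take-drop k (λ b → ⟦ (without ++ with₀) b p ⟧ * (y ++ z) b)) ⟩
      ⟦ single₀ p ⟧ + (sum {k} (λ i → ⟦ (without ++ with₀) (i ↑ˡ k) p ⟧ * (y ++ z) (i ↑ˡ k))
                     + sum {k} (λ i → ⟦ (without ++ with₀) (k ↑ʳ i) p ⟧ * (y ++ z) (k ↑ʳ i)))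
        ≈⟨ +-congˡ (+-cong
             (sum-cong-≋ {k} (λ i →
               reflexive (≡.cong₂ (λ T → ⟦ T p ⟧ *_) (lookup-++ˡ without with₀ i) (lookup-++ˡ y z i))))
             (sum-cong-≋ {k} (λ i →
               reflexive (≡.cong₂ (λ T → ⟦ T p ⟧ *_) (lookup-++ʳ without with₀ i) (lookup-++ʳ y z i))))) ⟩
      ⟦ single₀ p ⟧ + (sum (λ i → ⟦ without i p ⟧ * y i) + sum (λ i → ⟦ with₀ i p ⟧ * z i))
        ≈⟨ +-congˡ (+-cong
             (sum-singleton (λ i → ⟦ without i p ⟧ * y i) _ (λ _ → zeroʳ _) (*-identityʳ _))
             (sum-singleton (λ i → ⟦ with₀ i p ⟧ * z i) _ (λ _ → zeroʳ _)
               (trans (sym (-‿distribʳ-* _ 1#)) (-‿cong (*-identityʳ _))))) ⟩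
      ⟦ single₀ p ⟧ + (⟦ single₁ p ⟧ - ⟦ pair p ⟧)
        ≈⟨ cancels p ⟩
      0# ∎
      where
      k = #nonemptySubsets (suc n)
      y z : Vector Carrier k
      y = 1# ∷ replicate _ 0#
      z = - 1# ∷ replicate _ 0#
      without with₀ : Vector (Vector Bool v) k
      without = map (false ∷_) (nonemptySubset (suc n))
      with₀   = map (true ∷_) (nonemptySubset (suc n))
      single₀ single₁ pair : Vector Bool v
      single₀ = true ∷ replicate (suc n) false
      single₁ = false ∷ (true ∷ replicate n false)
      pair    = true ∷ (true ∷ replicate n false)
      cancels : ∀ p → ⟦ single₀ p ⟧ + (⟦ single₁ p ⟧ - ⟦ pair p ⟧) ≈ 0#
      cancels zero          = trans (+-congˡ (+-identityˡ _)) (-‿inverseʳ 1#)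
      cancels (suc zero)    = trans (+-identityˡ _) (-‿inverseʳ 1#)
      cancels (suc (suc p)) = trans (+-identityˡ _) (-‿inverseʳ 0#)

    0-eigenvalue : HasEigenvalue (subsetAdjacency v) 0#
    0-eigenvalue = replicate v 0# ++ kernelVector
      , (v ↑ʳ zero , ≡.subst (_# 0#) (≡.sym (lookup-++ʳ (replicate v 0#) kernelVector zero)) 1#0)
      , kernel-eigenvector B kernelVector kernelVector-kernel

    -- The eigenvector is (μ x, Nᵀ x); its entry μ x₀ at the first point witnesses that it is
    -- nonzero.
    gram-eigenvalue : ∀ μ (x : Vector Carrier v) → μ # 0# → x zero # 0# →
      (∀ p → 2# ^ n * (x p + sum x) ≈ μ * (μ * x p)) → HasEigenvalue (subsetAdjacency v) μ
    gram-eigenvalue μ x μ#0 x₀#0 gram-x = y ++ z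
      , (_↑ˡ_ {v} zero (#nonemptySubsets v)
        , ≡.subst (_# 0#) (≡.sym (lookup-++ˡ y z zero)) (*-#0 {μ} {x zero} μ#0 x₀#0))
      , gram-eigenvector B (2# ^ n) (sum-total-containing n) μ x gram-x
      where
      y : Vector Carrier v
      y p = μ * x p
      z : Vector Carrier (#nonemptySubsets v)
      z b = total x (B b)

    -- The vector x with entries 1 and -1 at the first two points sums to zero, so J kills it and I
    -- + J fixes it.
    √c-eigenvalue : ∀ μ → μ # 0# → μ * μ ≈ 2# ^ n → HasEigenvalue (subsetAdjacency v) μ
    √c-eigenvalue μ μ#0 μμ≈c = gram-eigenvalue μ x μ#0 1#0 (λ p → begin
      2# ^ n * (x p + sum x)    ≈⟨ *-cong (sym μμ≈c) (trans (+-congˡ sum-x≈0) (+-identityʳ (x p))) ⟩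
      μ * μ * x p               ≈⟨ *-assoc μ μ (x p) ⟩
      μ * (μ * x p)             ∎)
      where
      x : Vector Carrier v
      x = 1# ∷ (- 1# ∷ replicate n 0#)
      sum-x≈0 : sum x ≈ 0#
      sum-x≈0 = trans (+-congˡ (sum-singleton (- 1# ∷ replicate n 0#) (- 1#) (λ _ → refl) refl)) (-‿inverseʳ 1#)

    -- On the all-ones vector I + J is multiplication by v + 1.
    √cN-eigenvalue : ∀ μ → μ # 0# → μ * μ ≈ 2# ^ n * (1# + sum {v} (λ _ → 1#)) → HasEigenvalue (subsetAdjacency v) μ
    √cN-eigenvalue μ μ#0 μμ≈cN = gram-eigenvalue μ (replicate v 1#) μ#0 1#0 (λ p → begin
      2# ^ n * (1# + sum {v} (λ _ → 1#))    ≈⟨ μμ≈cN ⟨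
      μ * μ                                 ≈⟨ *-congˡ (*-identityʳ μ) ⟨
      μ * (μ * 1#)                          ∎)

  -- Here s = 2 + k and s² = v + 1 with v = 2 + 2e. Writing s this way exhibits s > 1, which makes
  -- `√cN` strictly larger than `√c`.
  module _ (e k : ℕ) (ss≡3+2e : suc (suc k) ℕ.* suc (suc k) ≡ suc (suc (suc (e ℕ.+ e)))) where

    private
      s n v : ℕ
      s = suc (suc k)
      n = e ℕ.+ e
      v = suc (suc n)
      B : Vector (Vector Bool v) (#nonemptySubsets v)
      B = nonemptySubset v

    √c √cN : Carrier
    √c = 2# ^ e
    √cN = √c * (s ×# 1#)

    eigenvalues : Vector Carrier 5
    eigenvalues = ±roots √c √cN

    √c²≈c : √c * √c ≈ 2# ^ n
    √c²≈c = sym (^-homo-* 2# e e)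

    √cN²≈cN : √cN * √cN ≈ 2# ^ n * (1# + sum {v} (λ _ → 1#))
    √cN²≈cN = begin
      √c * (s ×# 1#) * (√c * (s ×# 1#))            ≈⟨ interchange √c (s ×# 1#) √c (s ×# 1#) ⟩
      √c * √c * ((s ×# 1#) * (s ×# 1#))            ≈⟨ *-cong √c²≈c (sym (×1-homo-* s s)) ⟩
      2# ^ n * ((s ℕ.* s) ×# 1#)                 ≈⟨ *-congˡ (×-congˡ ss≡3+2e) ⟩
      2# ^ n * (suc v ×# 1#)                     ≈⟨ *-congˡ (sum-replicate (suc v)) ⟨
      2# ^ n * (1# + sum {v} (λ _ → 1#))         ∎

    eigenvalues-apart : ∀ i j → i ≢ j → eigenvalues i # eigenvalues j
    eigenvalues-apart =
      let p , 0<p , √c≐p = 2^-rational e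
          r , 0≤r , k≐r = ×1-rational k
          1<s : 1ℚ ℚ.< 1ℚ ℚ.+ (1ℚ ℚ.+ r)
          1<s = ≡.subst (ℚ._< 1ℚ ℚ.+ (1ℚ ℚ.+ r)) (ℚₚ.+-identityʳ 1ℚ)
                  (ℚₚ.+-monoʳ-< 1ℚ {0ℚ} {1ℚ ℚ.+ r} (ℚₚ.+-mono-<-≤ {0ℚ} {1ℚ} {0ℚ} {r} (ℚₚ.positive⁻¹ 1ℚ) 0≤r))
      in ±roots-apart √c≐p (≐-* √c≐p (≐-+ ≐-1 (≐-+ ≐-1 k≐r))) 0<p
           (≡.subst (ℚ._< p ℚ.* (1ℚ ℚ.+ (1ℚ ℚ.+ r))) (ℚₚ.*-identityʳ p)
             (ℚₚ.*-monoʳ-<-pos p {{ℚ.positive 0<p}} 1<s))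

    eigenvalues-sound : ∀ i → HasEigenvalue (subsetAdjacency (suc (suc (e ℕ.+ e)))) (eigenvalues i)
    eigenvalues-sound zero = 0-eigenvalue n
    -- The eigenvalue at index `zero` is 0, so pairwise apartness also shows that the others are
    -- apart from 0.
    eigenvalues-sound i@(suc zero) = √c-eigenvalue n √c (eigenvalues-apart i zero (λ ())) √c²≈c
    eigenvalues-sound i@(suc (suc zero)) =
      √c-eigenvalue n (- √c) (eigenvalues-apart i zero (λ ())) (trans (neg*neg √c) √c²≈c)
    eigenvalues-sound i@(suc (suc (suc zero))) =
      √cN-eigenvalue n √cN (eigenvalues-apart i zero (λ ())) √cN²≈cN
    eigenvalues-sound i@(suc (suc (suc (suc zero)))) =
      √cN-eigenvalue n (- √cN) (eigenvalues-apart i zero (λ ())) (trans (neg*neg √cN) √cN²≈cN)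

    -- The product annihilates every coordinate of the eigenvector; it is used at the coordinate u
    -- known to be apart from 0, which can then be cancelled.
    eigenvalues-complete : ∀ μ → HasEigenvalue (subsetAdjacency (suc (suc (e ℕ.+ e)))) μ → ∃[ i ] μ ≈ eigenvalues i
    eigenvalues-complete μ (w , (u , wᵤ#0) , Aw≈μw) =
      rootProduct≈0⇒∃root eigenvalues eigenvalues-apart μ (w u) wᵤ#0
        (eigenvector-annihilated B (2# ^ n) (sum-total-containing n) √c √cN √c²≈c √cN²≈cN μ w Aw≈μw u)

-- The solution s = 3 + 2m, e = m + (2m² + 5m + 3) of s² = 3 + 2e.
square : ∀ m → let e = m ℕ.+ (m ℕ.* m ℕ.+ m ℕ.* m ℕ.+ 5 ℕ.* m ℕ.+ 3) in
  suc (suc (suc (m ℕ.+ m))) ℕ.* suc (suc (suc (m ℕ.+ m))) ≡ suc (suc (suc (e ℕ.+ e)))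
square = solve 1 (λ m → let e = m :+ (m :* m :+ m :* m :+ con 5 :* m :+ con 3) in
  (con 3 :+ (m :+ m)) :* (con 3 :+ (m :+ m)) := con 3 :+ (e :+ e)) ≡.refl
  where open ℕ-Solver using (solve; _:=_; _:+_; _:*_; con)

open import Defs

-- The graph of points and subsets

open Algebra.Properties.CommutativeMonoid.Sum ℕₚ.+-0-commutativeMonoid using ()
  renaming (sum to sumℕ; sum-cong-≗ to sumℕ-cong-≗; sum-replicate-zero to sumℕ-replicate-zero)
open SplitSum ℕₚ.+-0-commutativeMonoid using () renaming (sum-take-drop to sumℕ-take-drop)

bit : Bool → ℕ
bit b = if b then 1 else 0

size : ∀ {n} → Vector Bool n → ℕ
size S = sumℕ (bit ∘ S)

-- The witness is the initial segment {0, ..., k}, found among the sets T ∪ {0} when k > 0.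
nonemptySubset-of-size : ∀ n (k : Fin n) → ∃[ b ] size (nonemptySubset n b) ≡ suc (toℕ k)
nonemptySubset-of-size (suc n) zero    = zero , ≡.cong suc (sumℕ-replicate-zero n)
nonemptySubset-of-size (suc n) (suc k) =
  let b , size-b = nonemptySubset-of-size n k in
  suc (#nonemptySubsets n ↑ʳ b)
  , ≡.trans (≡.cong size (lookup-++ʳ (map (false ∷_) (nonemptySubset n)) (map (true ∷_) (nonemptySubset n)) b))
            (≡.cong suc size-b)

nonemptySubset-full : ∀ n → ∃[ b ] ∀ p → nonemptySubset (suc n) b p ≡ true
nonemptySubset-full zero    = zero , λ { zero → ≡.refl }
nonemptySubset-full (suc n) =
  let b , full = nonemptySubset-full n in
  suc (#nonemptySubsets (suc n) ↑ʳ b)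
  , λ p → ≡.trans (≡.cong (λ S → S p) (lookup-++ʳ
                        (map (false ∷_) (nonemptySubset (suc n))) (map (true ∷_) (nonemptySubset (suc n))) b))
                  (full-∷ full p)
  where
  full-∷ : ∀ {m} {S : Vector Bool m} → (∀ p → S p ≡ true) → ∀ p → (true ∷ S) p ≡ true
  full-∷ full zero    = ≡.refl
  full-∷ full (suc p) = full p

nonemptySubset-nonempty : ∀ n b → ∃[ p ] nonemptySubset n b p ≡ true
nonemptySubset-nonempty (suc n) zero    = zero , ≡.refl
nonemptySubset-nonempty (suc n) (suc b) = ↑-elim (#nonemptySubsets n)
  (λ b → ∃[ p ] nonemptySubset (suc n) (suc b) p ≡ true)
  (λ b → let p , p∈b = nonemptySubset-nonempty n b in
    suc p , ≡.trans (≡.cong (λ S → S (suc p)) (lookup-++ˡ without with₀ b)) p∈b)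
  (λ b → zero , ≡.cong (λ S → S zero) (lookup-++ʳ without with₀ b))
  b
  where
  without with₀ : Vector (Vector Bool (suc n)) (#nonemptySubsets n)
  without = map (false ∷_) (nonemptySubset n)
  with₀   = map (true ∷_) (nonemptySubset n)

length-filter-tabulate : ∀ {a p} {A : Set a} {P : Pred A p} (P? : Decidable P) {n} (f : Fin n → A) →
                         length (filter P? (tabulate f)) ≡ sumℕ (λ i → bit (does (P? (f i))))
length-filter-tabulate P? {zero}  f = ≡.refl
length-filter-tabulate P? {suc n} f with does (P? (f zero))
... | true  = ≡.cong suc (length-filter-tabulate P? (f ∘ suc))
... | false = length-filter-tabulate P? (f ∘ suc)

-- Sending i to the position of `f i` in the list is injective, since equal positions hold equal
-- values.
distinctValencies-≥ : ∀ (G : Graph) {m} (f : Fin m → ℕ) → (∀ {i j} → f i ≡ f j → i ≡ j) →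
                      (∀ i → ∃[ u ] Graph.valency G u ≡ f i) → m ℕ.≤ length (Graph.distinctValencies G)
distinctValencies-≥ G f f-injective attained = Fin.injective⇒≤ {f = index ∘ f∈} (λ {i} {j} eq →
  f-injective (SetoidMembership.index-injective (≡.setoid ℕ) (f∈ i) (f∈ j) eq))
  where
  f∈ : ∀ i → f i ∈ Graph.distinctValencies G
  f∈ i = let u , valency-u = attained i in
    ∈-deduplicate⁺ ℕₚ._≟_ (≡.subst (_∈ _) valency-u (∈-map⁺ (Graph.valency G) (∈-allFin u)))

module _ {n k} (B : Vector (Vector Bool n) k) where

  private
    incident-sym : ∀ s t → T (incident B s t) → T (incident B t s)
    incident-sym (inj₁ _) (inj₂ _) s~t = s~t
    incident-sym (inj₂ _) (inj₁ _) s~t = s~t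

    incident-irrefl : ∀ s → incident B s s ≡ false
    incident-irrefl (inj₁ _) = ≡.refl
    incident-irrefl (inj₂ _) = ≡.refl

    isPoint : Fin n ⊎ Fin k → Bool
    isPoint (inj₁ _) = true
    isPoint (inj₂ _) = false

    isPoint-≢ : ∀ s t → T (incident B s t) → isPoint s ≢ isPoint t
    isPoint-≢ (inj₁ _) (inj₂ _) _ ()
    isPoint-≢ (inj₂ _) (inj₁ _) _ ()

  incidenceGraph : Graph
  incidenceGraph = record
    { order    = n ℕ.+ k
    ; _~_      = λ u w → T (adjacent B u w)
    ; _~?_     = λ u w → T? (adjacent B u w)
    ; ~-sym    = λ {u} {w} → incident-sym (splitAt n u) (splitAt n w)
    ; ~-irrefl = λ { {u} ≡.refl u~u → ≡.subst T (incident-irrefl (splitAt n u)) u~u }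
    }

  open Graph incidenceGraph

  incidenceGraph-bipartite : Bipartite
  incidenceGraph-bipartite = isPoint ∘ splitAt n , λ {u} {w} → isPoint-≢ (splitAt n u) (splitAt n w)

  point~block : ∀ {p b} → B b p ≡ true → (p ↑ˡ k) ~ (n ↑ʳ b)
  point~block {p} {b} p∈b = Equivalence.from T-≡ (≡.trans (adjacent-pb B p b) p∈b)

  -- A block containing every point is adjacent to all points, and any nonempty block reaches it
  -- through one of its own points; all vertices are joined through this block.
  incidenceGraph-connected : (∃[ b ] ∀ p → B b p ≡ true) → (∀ b → ∃[ p ] B b p ≡ true) → Connected
  incidenceGraph-connected (full , ∈full) nonempty u w = to-full u ◅◅ reverse (λ {u} {w} → ~-sym {u} {w}) (to-full w)
    where
    to-full : ∀ u → Star _~_ u (n ↑ʳ full)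
    to-full = ↑-elim n (λ u → Star _~_ u (n ↑ʳ full))
      (λ p → point~block (∈full p) ◅ Star.ε)
      (λ b → let p , p∈b = nonempty b in
        ~-sym {p ↑ˡ k} {n ↑ʳ b} (point~block p∈b) ◅ point~block (∈full p) ◅ Star.ε)

  block-valency : ∀ b → valency (n ↑ʳ b) ≡ size (B b)
  block-valency b = begin
    valency (n ↑ʳ b)
      ≡⟨ length-filter-tabulate ((n ↑ʳ b) ~?_) (λ w → w) ⟩
    sumℕ (λ w → bit (adjacent B (n ↑ʳ b) w))
      ≡⟨ sumℕ-take-drop n (λ w → bit (adjacent B (n ↑ʳ b) w)) ⟩
    sumℕ (λ p → bit (adjacent B (n ↑ʳ b) (p ↑ˡ k))) ℕ.+ sumℕ (λ d → bit (adjacent B (n ↑ʳ b) (n ↑ʳ d)))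
      ≡⟨ ≡.cong₂ ℕ._+_ (sumℕ-cong-≗ (λ p → ≡.cong bit (adjacent-bp B b p)))
                       (≡.trans (sumℕ-cong-≗ (λ d → ≡.cong bit (adjacent-bb B b d))) (sumℕ-replicate-zero k)) ⟩
    size (B b) ℕ.+ 0
      ≡⟨ ℕₚ.+-identityʳ _ ⟩
    size (B b) ∎
    where open ≡.≡-Reasoning

-- The real numbers as a ring with apartness

-- `x ≈ y` and `x # y` unfold to `Null (x ⊖ y)` and `Apart (x ⊖ y)`, which reduces both relations to
-- facts about rational sequences.
Null Apart : (ℕ → ℚ) → Set
Null f  = ∀ ε → 0ℚ ℚ.< ε → ∃[ N ] ∀ n → N ℕ.≤ n → ∣ f n ∣ ℚ.< ε
Apart f = ∃[ ε ] (0ℚ ℚ.< ε × ∃[ N ] ∀ n → N ℕ.≤ n → ε ℚ.≤ ∣ f n ∣)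

private
  open ℚ-Solver using (solve; _:=_; _:+_; _:*_; _:-_; :-_)

  half-+-half : ∀ ε → ½ ℚ.* ε ℚ.+ ½ ℚ.* ε ≡ ε
  half-+-half ε = ≡.trans (≡.sym (ℚₚ.*-distribʳ-+ ε ½ ½)) (ℚₚ.*-identityˡ ε)

  half-pos : ∀ {ε} → 0ℚ ℚ.< ε → 0ℚ ℚ.< ½ ℚ.* ε
  half-pos {ε} 0<ε = ℚₚ.positive⁻¹ _ {{ℚₚ.pos*pos⇒pos ½ ε {{ℚ.positive 0<ε}}}}

  *-pos : ∀ {p q} → 0ℚ ℚ.< p → 0ℚ ℚ.< q → 0ℚ ℚ.< p ℚ.* q
  *-pos {p} {q} 0<p 0<q = ℚₚ.positive⁻¹ _ {{ℚₚ.pos*pos⇒pos p {{ℚ.positive 0<p}} q {{ℚ.positive 0<q}}}}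

  quotient : ∀ {b} ε → 0ℚ ℚ.< b → 0ℚ ℚ.< ε → ∃[ δ ] (0ℚ ℚ.< δ × b ℚ.* δ ≡ ε)
  quotient {b} ε 0<b 0<ε = b⁻¹ ℚ.* ε
    , *-pos (ℚₚ.positive⁻¹ b⁻¹ {{ℚₚ.1/pos⇒pos b {{b-pos}}}}) 0<ε
    , ≡.trans (≡.sym (ℚₚ.*-assoc b b⁻¹ ε))
        (≡.trans (≡.cong (ℚ._* ε) (ℚₚ.*-inverseʳ b {{b≢0}})) (ℚₚ.*-identityˡ ε))
    where
    b-pos = ℚ.positive 0<b
    b≢0   = ℚₚ.pos⇒nonZero b {{b-pos}}
    b⁻¹   = ℚ.1/_ b {{b≢0}}

  x+[y-x]≡y : ∀ x y → x ℚ.+ (y ℚ.- x) ≡ y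
  x+[y-x]≡y = solve 2 (λ x y → x :+ (y :- x) := y) ≡.refl

  x-0≡x : ∀ x → x ℚ.- 0ℚ ≡ x
  x-0≡x = ℚₚ.+-identityʳ

Null-abs : ∀ {f g} → (∀ n → ∣ f n ∣ ≡ ∣ g n ∣) → Null f → Null g
Null-abs f≡g null ε 0<ε with null ε 0<ε
... | N , small = N , λ n N≤n → ≡.subst (ℚ._< ε) (f≡g n) (small n N≤n)

Null-≗ : ∀ {f g} → (∀ n → f n ≡ g n) → Null f → Null g
Null-≗ f≡g = Null-abs (λ n → ≡.cong ∣_∣ (f≡g n))

Null-0 : Null (λ _ → 0ℚ)
Null-0 ε 0<ε = 0 , λ _ _ → 0<ε

Null-neg : ∀ {f} → Null f → Null (λ n → ℚ.- f n)
Null-neg {f} = Null-abs (λ n → ≡.sym (ℚₚ.∣-p∣≡∣p∣ (f n)))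

Null-+ : ∀ {f g} → Null f → Null g → Null (λ n → f n ℚ.+ g n)
Null-+ {f} {g} null-f null-g ε 0<ε with null-f (½ ℚ.* ε) (half-pos 0<ε) | null-g (½ ℚ.* ε) (half-pos 0<ε)
... | M , small-f | N , small-g = M ℕ.⊔ N , λ n ≤n → begin-strict
  ∣ f n ℚ.+ g n ∣         ≤⟨ ℚₚ.∣p+q∣≤∣p∣+∣q∣ (f n) (g n) ⟩
  ∣ f n ∣ ℚ.+ ∣ g n ∣     <⟨ ℚₚ.+-mono-< (small-f n (ℕₚ.m⊔n≤o⇒m≤o M N ≤n)) (small-g n (ℕₚ.m⊔n≤o⇒n≤o M N ≤n)) ⟩
  ½ ℚ.* ε ℚ.+ ½ ℚ.* ε     ≡⟨ half-+-half ε ⟩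
  ε                       ∎
  where open ℚₚ.≤-Reasoning

eventually-bounded : ∀ x → ∃[ b ] (0ℚ ℚ.< b × ∃[ N ] ∀ n → N ℕ.≤ n → ∣ seq x n ∣ ℚ.≤ b)
eventually-bounded x with cauchy x 1ℚ (ℚₚ.positive⁻¹ 1ℚ)
... | N , close = ∣ seq x N ∣ ℚ.+ 1ℚ
  , ℚₚ.+-mono-≤-< (ℚₚ.0≤∣p∣ (seq x N)) (ℚₚ.positive⁻¹ 1ℚ)
  , N , λ n N≤n → begin
    ∣ seq x n ∣                                   ≡⟨ ≡.cong ∣_∣ (x+[y-x]≡y (seq x N) (seq x n)) ⟨
    ∣ seq x N ℚ.+ (seq x n ℚ.- seq x N) ∣         ≤⟨ ℚₚ.∣p+q∣≤∣p∣+∣q∣ (seq x N) (seq x n ℚ.- seq x N) ⟩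
    ∣ seq x N ∣ ℚ.+ ∣ seq x n ℚ.- seq x N ∣       ≤⟨ ℚₚ.+-monoʳ-≤ ∣ seq x N ∣ (ℚₚ.<⇒≤ (close n N N≤n ℕₚ.≤-refl)) ⟩
    ∣ seq x N ∣ ℚ.+ 1ℚ                            ∎
  where open ℚₚ.≤-Reasoning

Null-* : ∀ x {f} → Null f → Null (λ n → seq x n ℚ.* f n)
Null-* x {f} null ε 0<ε =
  let b , 0<b , M , x≤b = eventually-bounded x
      δ , 0<δ , bδ≡ε    = quotient ε 0<b 0<ε
      N , small         = null δ 0<δ
  in M ℕ.⊔ N , λ n ≤n → begin-strict
    ∣ seq x n ℚ.* f n ∣       ≡⟨ ℚₚ.∣p*q∣≡∣p∣*∣q∣ (seq x n) (f n) ⟩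
    ∣ seq x n ∣ ℚ.* ∣ f n ∣   ≤⟨ ℚₚ.*-monoʳ-≤-nonNeg ∣ f n ∣ {{ℚₚ.∣-∣-nonNeg (f n)}} (x≤b n (ℕₚ.m⊔n≤o⇒m≤o M N ≤n)) ⟩
    b ℚ.* ∣ f n ∣             <⟨ ℚₚ.*-monoʳ-<-pos b {{ℚ.positive 0<b}} (small n (ℕₚ.m⊔n≤o⇒n≤o M N ≤n)) ⟩
    b ℚ.* δ                   ≡⟨ bδ≡ε ⟩
    ε                         ∎
  where open ℚₚ.≤-Reasoning

_⊖_ : ℝ → ℝ → ℕ → ℚ
(x ⊖ y) n = seq x n ℚ.- seq y n

-- The operations of ℝ act termwise, so through this lemma the ring identities of ℝ are those of ℚ
-- at each index.
≗⇒≈ : ∀ {x y} → (∀ n → seq x n ≡ seq y n) → x ≈ y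
≗⇒≈ {x} {y} x≡y = Null-≗ {λ _ → 0ℚ} {x ⊖ y}
  (λ n → ≡.sym (≡.trans (≡.cong (ℚ._- seq y n) (x≡y n)) (ℚₚ.+-inverseʳ (seq y n)))) Null-0

≈-refl : ∀ {x} → x ≈ x
≈-refl {x} = ≗⇒≈ {x} {x} (λ _ → ≡.refl)

≈-sym : ∀ {x y} → x ≈ y → y ≈ x
≈-sym {x} {y} x≈y = Null-≗ {λ n → ℚ.- (x ⊖ y) n} {y ⊖ x}
  (λ n → solve 2 (λ p q → :- (p :- q) := q :- p) ≡.refl (seq x n) (seq y n)) (Null-neg {x ⊖ y} x≈y)

≈-trans : ∀ {x y z} → x ≈ y → y ≈ z → x ≈ z
≈-trans {x} {y} {z} x≈y y≈z = Null-≗ {λ n → (x ⊖ y) n ℚ.+ (y ⊖ z) n} {x ⊖ z}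
  (λ n → solve 3 (λ p q r → (p :- q) :+ (q :- r) := p :- r) ≡.refl (seq x n) (seq y n) (seq z n))
  (Null-+ {x ⊖ y} {y ⊖ z} x≈y y≈z)

+-cong : ∀ {x x′ y y′} → x ≈ x′ → y ≈ y′ → x + y ≈ x′ + y′
+-cong {x} {x′} {y} {y′} x≈x′ y≈y′ = Null-≗ {λ n → (x ⊖ x′) n ℚ.+ (y ⊖ y′) n} {(x + y) ⊖ (x′ + y′)}
  (λ n → solve 4 (λ p p′ q q′ → (p :- p′) :+ (q :- q′) := (p :+ q) :- (p′ :+ q′)) ≡.refl
           (seq x n) (seq x′ n) (seq y n) (seq y′ n))
  (Null-+ {x ⊖ x′} {y ⊖ y′} x≈x′ y≈y′)

-‿cong : ∀ {x y} → x ≈ y → - x ≈ - y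
-‿cong {x} {y} x≈y = Null-≗ {λ n → ℚ.- (x ⊖ y) n} {(- x) ⊖ (- y)}
  (λ n → solve 2 (λ p q → :- (p :- q) := :- p :- :- q) ≡.refl (seq x n) (seq y n)) (Null-neg {x ⊖ y} x≈y)

*-cong : ∀ {x x′ y y′} → x ≈ x′ → y ≈ y′ → x * y ≈ x′ * y′
*-cong {x} {x′} {y} {y′} x≈x′ y≈y′ =
  Null-≗ {λ n → seq y n ℚ.* (x ⊖ x′) n ℚ.+ seq x′ n ℚ.* (y ⊖ y′) n} {(x * y) ⊖ (x′ * y′)}
    (λ n → solve 4 (λ p p′ q q′ → q :* (p :- p′) :+ p′ :* (q :- q′) := p :* q :- p′ :* q′) ≡.refl
             (seq x n) (seq x′ n) (seq y n) (seq y′ n))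
    (Null-+ {λ n → seq y n ℚ.* (x ⊖ x′) n} {λ n → seq x′ n ℚ.* (y ⊖ y′) n}
      (Null-* y {x ⊖ x′} x≈x′) (Null-* x′ {y ⊖ y′} y≈y′))

ℝ-commutativeRing : CommutativeRing 0ℓ 0ℓ
ℝ-commutativeRing = record
  { Carrier = ℝ ; _≈_ = _≈_ ; _+_ = _+_ ; _*_ = _*_ ; -_ = -_ ; 0# = 0ℝ ; 1# = 1ℝ
  ; isCommutativeRing = record
    { isRing = record
      { +-isAbelianGroup = record
        { isGroup = record
          { isMonoid = record
            { isSemigroup = record
              { isMagma = record
                { isEquivalence = record
                  { refl  = λ {x} → ≈-refl {x}
                  ; sym   = λ {x} {y} → ≈-sym {x} {y}
                  ; trans = λ {x} {y} {z} → ≈-trans {x} {y} {z}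
                  }
                ; ∙-cong = λ {x} {x′} {y} {y′} → +-cong {x} {x′} {y} {y′}
                }
              ; assoc = λ x y z → ≗⇒≈ {(x + y) + z} {x + (y + z)} (λ n → ℚₚ.+-assoc (seq x n) (seq y n) (seq z n))
              }
            ; identity = (λ x → ≗⇒≈ {0ℝ + x} {x} (λ n → ℚₚ.+-identityˡ (seq x n)))
                       , (λ x → ≗⇒≈ {x + 0ℝ} {x} (λ n → ℚₚ.+-identityʳ (seq x n)))
            }
          ; inverse = (λ x → ≗⇒≈ {(- x) + x} {0ℝ} (λ n → ℚₚ.+-inverseˡ (seq x n)))
                    , (λ x → ≗⇒≈ {x + - x} {0ℝ} (λ n → ℚₚ.+-inverseʳ (seq x n)))
          ; ⁻¹-cong = λ {x} {y} → -‿cong {x} {y}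
          }
        ; comm = λ x y → ≗⇒≈ {x + y} {y + x} (λ n → ℚₚ.+-comm (seq x n) (seq y n))
        }
      ; *-cong = λ {x} {x′} {y} {y′} → *-cong {x} {x′} {y} {y′}
      ; *-assoc = λ x y z → ≗⇒≈ {(x * y) * z} {x * (y * z)} (λ n → ℚₚ.*-assoc (seq x n) (seq y n) (seq z n))
      ; *-identity = (λ x → ≗⇒≈ {1ℝ * x} {x} (λ n → ℚₚ.*-identityˡ (seq x n)))
                   , (λ x → ≗⇒≈ {x * 1ℝ} {x} (λ n → ℚₚ.*-identityʳ (seq x n)))
      ; distrib = (λ x y z → ≗⇒≈ {x * (y + z)} {x * y + x * z} (λ n → ℚₚ.*-distribˡ-+ (seq x n) (seq y n) (seq z n)))
                , (λ x y z → ≗⇒≈ {(y + z) * x} {y * x + z * x} (λ n → ℚₚ.*-distribʳ-+ (seq x n) (seq y n) (seq z n)))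
      }
    ; *-comm = λ x y → ≗⇒≈ {x * y} {y * x} (λ n → ℚₚ.*-comm (seq x n) (seq y n))
    }
  }

Apart-≗ : ∀ {f g} → (∀ n → f n ≡ g n) → Apart f → Apart g
Apart-≗ f≡g (ε , 0<ε , N , far) = ε , 0<ε , N , λ n N≤n → ≡.subst (λ p → ε ℚ.≤ ∣ p ∣) (f≡g n) (far n N≤n)

Apart-* : ∀ {f g} → Apart f → Apart g → Apart (λ n → f n ℚ.* g n)
Apart-* {f} {g} (ε , 0<ε , M , far-f) (δ , 0<δ , N , far-g) =
  ε ℚ.* δ , *-pos 0<ε 0<δ , M ℕ.⊔ N , λ n ≤n → begin
    ε ℚ.* δ               ≤⟨ ℚₚ.*-monoʳ-≤-nonNeg δ {{ℚₚ.pos⇒nonNeg δ {{ℚ.positive 0<δ}}}}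
                               (far-f n (ℕₚ.m⊔n≤o⇒m≤o M N ≤n)) ⟩
    ∣ f n ∣ ℚ.* δ         ≤⟨ ℚₚ.*-monoˡ-≤-nonNeg ∣ f n ∣ {{ℚₚ.∣-∣-nonNeg (f n)}} (far-g n (ℕₚ.m⊔n≤o⇒n≤o M N ≤n)) ⟩
    ∣ f n ∣ ℚ.* ∣ g n ∣   ≡⟨ ℚₚ.∣p*q∣≡∣p∣*∣q∣ (f n) (g n) ⟨
    ∣ f n ℚ.* g n ∣       ∎
  where open ℚₚ.≤-Reasoning

-- Eventually ∣f∣ is at least δ, so ∣f g∣ < δ ε forces ∣g∣ < ε.
Apart-Null-cancel : ∀ {f g} → Apart f → Null (λ n → f n ℚ.* g n) → Null g
Apart-Null-cancel {f} {g} (δ , 0<δ , M , far) null ε 0<ε with null (δ ℚ.* ε) (*-pos 0<δ 0<ε)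
... | N , small = M ℕ.⊔ N , λ n ≤n →
  ℚₚ.*-cancelˡ-<-nonNeg δ {{ℚₚ.pos⇒nonNeg δ {{ℚ.positive 0<δ}}}} (begin-strict
    δ ℚ.* ∣ g n ∣         ≤⟨ ℚₚ.*-monoʳ-≤-nonNeg ∣ g n ∣ {{ℚₚ.∣-∣-nonNeg (g n)}} (far n (ℕₚ.m⊔n≤o⇒m≤o M N ≤n)) ⟩
    ∣ f n ∣ ℚ.* ∣ g n ∣   ≡⟨ ℚₚ.∣p*q∣≡∣p∣*∣q∣ (f n) (g n) ⟨
    ∣ f n ℚ.* g n ∣       <⟨ small n (ℕₚ.m⊔n≤o⇒n≤o M N ≤n) ⟩
    δ ℚ.* ε               ∎)
  where open ℚₚ.≤-Reasoning

-- A single term of absolute value at least 2h suffices: later terms differ from it by less than h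
-- and so cannot drop below h.
Apart-from-one-term : ∀ x h N → 0ℚ ℚ.< h →
  (∀ m n → N ℕ.≤ m → N ℕ.≤ n → ∣ seq x m ℚ.- seq x n ∣ ℚ.< h) →
  ∀ n → N ℕ.≤ n → h ℚ.+ h ℚ.≤ ∣ seq x n ∣ → Apart (seq x)
Apart-from-one-term x h N 0<h close n N≤n far = h , 0<h , n , λ m n≤m →
  ℚₚ.≮⇒≥ (λ small → ℚₚ.<-irrefl ≡.refl (ℚₚ.≤-<-trans far (begin-strict
    ∣ seq x n ∣                                     ≡⟨ ≡.cong ∣_∣ (x+[y-x]≡y (seq x m) (seq x n)) ⟨
    ∣ seq x m ℚ.+ (seq x n ℚ.- seq x m) ∣           ≤⟨ ℚₚ.∣p+q∣≤∣p∣+∣q∣ (seq x m) (seq x n ℚ.- seq x m) ⟩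
    ∣ seq x m ∣ ℚ.+ ∣ seq x n ℚ.- seq x m ∣         <⟨ ℚₚ.+-mono-< small (close n m N≤n (ℕₚ.≤-trans N≤n n≤m)) ⟩
    h ℚ.+ h                                         ∎)))
  where open ℚₚ.≤-Reasoning

half-≤-summand : ∀ {ε p q} → ε ℚ.≤ p ℚ.+ q → ½ ℚ.* ε ℚ.≤ p ⊎ ½ ℚ.* ε ℚ.≤ q
half-≤-summand {ε} {p} {q} ε≤p+q with ½ ℚ.* ε ℚₚ.≤? p | ½ ℚ.* ε ℚₚ.≤? q
... | yes ≤p | _      = inj₁ ≤p
... | no  _  | yes ≤q = inj₂ ≤q
... | no  ≰p | no  ≰q = ⊥-elim (ℚₚ.<-irrefl ≡.refl (ℚₚ.≤-<-trans ε≤p+q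
  (≡.subst (p ℚ.+ q ℚ.<_) (half-+-half ε) (ℚₚ.+-mono-< (ℚₚ.≰⇒> ≰p) (ℚₚ.≰⇒> ≰q)))))

-- This carries cotransitivity, with z - x and z - y as the two sequences. The choice is made by
-- comparing rationals at one late index, where one of the two terms has absolute value at least
-- ε/2; the Cauchy condition for h = ε/4 extends it to all later indices.
Apart-summand : ∀ x y {ε} → 0ℚ ℚ.< ε → ∀ K → (∀ n → K ℕ.≤ n → ε ℚ.≤ ∣ seq x n ∣ ℚ.+ ∣ seq y n ∣) →
                Apart (seq x) ⊎ Apart (seq y)
Apart-summand x y {ε} 0<ε K far = choose (cauchy x h 0<h) (cauchy y h 0<h)
  where
  h   = ½ ℚ.* (½ ℚ.* ε)
  0<h = half-pos (half-pos 0<ε)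
  h+h≤ : ∀ {p} → ½ ℚ.* ε ℚ.≤ p → h ℚ.+ h ℚ.≤ p
  h+h≤ {p} = ≡.subst (ℚ._≤ p) (≡.sym (half-+-half (½ ℚ.* ε)))
  choose : (∃[ M ] ∀ m n → M ℕ.≤ m → M ℕ.≤ n → ∣ seq x m ℚ.- seq x n ∣ ℚ.< h) →
           (∃[ N ] ∀ m n → N ℕ.≤ m → N ℕ.≤ n → ∣ seq y m ℚ.- seq y n ∣ ℚ.< h) →
           Apart (seq x) ⊎ Apart (seq y)
  choose (M , close-x) (N , close-y) with half-≤-summand (far (K ℕ.⊔ (M ℕ.⊔ N)) (ℕₚ.m≤m⊔n K (M ℕ.⊔ N)))
  ... | inj₁ far-x = inj₁ (Apart-from-one-term x h M 0<h close-x _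
                       (ℕₚ.≤-trans (ℕₚ.m≤m⊔n M N) (ℕₚ.m≤n⊔m K (M ℕ.⊔ N))) (h+h≤ far-x))
  ... | inj₂ far-y = inj₂ (Apart-from-one-term y h N 0<h close-y _
                       (ℕₚ.≤-trans (ℕₚ.m≤n⊔m M N) (ℕₚ.m≤n⊔m K (M ℕ.⊔ N))) (h+h≤ far-y))

#-cotrans : ∀ {x y} → x # y → ∀ z → z # x ⊎ z # y
#-cotrans {x} {y} (ε , 0<ε , K , far) z = Apart-summand (z + - x) (z + - y) 0<ε K (λ n K≤n → begin
  ε                                                   ≤⟨ far n K≤n ⟩
  ∣ seq x n ℚ.- seq y n ∣                             ≡⟨ ≡.cong ∣_∣ (split (seq x n) (seq y n) (seq z n)) ⟩
  ∣ (seq z n ℚ.- seq y n) ℚ.- (seq z n ℚ.- seq x n) ∣ ≤⟨ ℚₚ.∣p-q∣≤∣p∣+∣q∣ (seq z n ℚ.- seq y n) (seq z n ℚ.- seq x n) ⟩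
  ∣ seq z n ℚ.- seq y n ∣ ℚ.+ ∣ seq z n ℚ.- seq x n ∣ ≡⟨ ℚₚ.+-comm ∣ seq z n ℚ.- seq y n ∣ ∣ seq z n ℚ.- seq x n ∣ ⟩
  ∣ seq z n ℚ.- seq x n ∣ ℚ.+ ∣ seq z n ℚ.- seq y n ∣ ∎)
  where
  open ℚₚ.≤-Reasoning
  split : ∀ p q r → p ℚ.- q ≡ (r ℚ.- q) ℚ.- (r ℚ.- p)
  split = solve 3 (λ p q r → p :- q := (r :- q) :- (r :- p)) ≡.refl

#-sym : ∀ {x y} → x # y → y # x
#-sym {x} {y} (ε , 0<ε , N , far) = ε , 0<ε , N , λ n N≤n → ≡.subst (ε ℚ.≤_) (swap (seq x n) (seq y n)) (far n N≤n)
  where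
  swap : ∀ p q → ∣ p ℚ.- q ∣ ≡ ∣ q ℚ.- p ∣
  swap p q = ≡.trans (≡.sym (ℚₚ.∣-p∣≡∣p∣ (p ℚ.- q)))
    (≡.cong ∣_∣ (solve 2 (λ p q → :- (p :- q) := q :- p) ≡.refl p q))

x#y⇒x-y#0 : ∀ {x y} → x # y → x + - y # 0ℝ
x#y⇒x-y#0 {x} {y} = Apart-≗ {x ⊖ y} {(x + - y) ⊖ 0ℝ} (λ n → ≡.sym (x-0≡x ((x ⊖ y) n)))

#0⇒Apart : ∀ {x} → x # 0ℝ → Apart (seq x)
#0⇒Apart {x} = Apart-≗ {x ⊖ 0ℝ} {seq x} (λ n → x-0≡x (seq x n))

Apart⇒#0 : ∀ {x} → Apart (seq x) → x # 0ℝ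
Apart⇒#0 {x} = Apart-≗ {seq x} {x ⊖ 0ℝ} (λ n → ≡.sym (x-0≡x (seq x n)))

*-#0 : ∀ {x y} → x # 0ℝ → y # 0ℝ → x * y # 0ℝ
*-#0 {x} {y} x#0 y#0 =
  Apart⇒#0 {x * y} (Apart-* {seq x} {seq y} (#0⇒Apart {x} x#0) (#0⇒Apart {y} y#0))

x#0∧xy≈0⇒y≈0 : ∀ {x y} → x # 0ℝ → x * y ≈ 0ℝ → y ≈ 0ℝ
x#0∧xy≈0⇒y≈0 {x} {y} x#0 xy≈0 = Null-≗ {seq y} {y ⊖ 0ℝ} (λ n → ≡.sym (x-0≡x (seq y n)))
  (Apart-Null-cancel {seq x} {seq y} (#0⇒Apart {x} x#0)
    (Null-≗ {(x * y) ⊖ 0ℝ} {seq (x * y)} (λ n → x-0≡x (seq (x * y) n)) xy≈0))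

-- Termwise equality rather than `≈`, so that it passes through the ring operations by congruence
-- alone.
Constant : ℝ → ℚ → Set
Constant x q = ∀ n → seq x n ≡ q

constant-# : ∀ {x y p q} → Constant x p → Constant y q → p ≢ q → x # y
constant-# {x} {y} {p} {q} x≡p y≡q p≢q = ∣ p ℚ.- q ∣ , ℚₚ.positive⁻¹ ∣ p ℚ.- q ∣ {{positive}}
  , 0 , λ n _ → ℚₚ.≤-reflexive (≡.sym (≡.cong₂ (λ p q → ∣ p ℚ.- q ∣) (x≡p n) (y≡q n)))
  where
  ≢0 : ∣ p ℚ.- q ∣ ≢ 0ℚ
  ≢0 eq = p≢q (begin
    p                      ≡⟨ ℚₚ.+-identityʳ p ⟨
    p ℚ.+ 0ℚ               ≡⟨ ≡.cong (p ℚ.+_) (ℚₚ.+-inverseˡ q) ⟨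
    p ℚ.+ (ℚ.- q ℚ.+ q)    ≡⟨ ℚₚ.+-assoc p (ℚ.- q) q ⟨
    p ℚ.- q ℚ.+ q          ≡⟨ ≡.cong (ℚ._+ q) (ℚₚ.∣p∣≡0⇒p≡0 (p ℚ.- q) eq) ⟩
    0ℚ ℚ.+ q               ≡⟨ ℚₚ.+-identityˡ q ⟩
    q                      ∎)
    where open ≡.≡-Reasoning
  positive : ℚ.Positive ∣ p ℚ.- q ∣
  positive = ℚₚ.nonNeg∧nonZero⇒pos ∣ p ℚ.- q ∣ {{ℚₚ.∣-∣-nonNeg (p ℚ.- q)}} {{ℚ.≢-nonZero ≢0}}

constant-+ : ∀ x y {p q} → Constant x p → Constant y q → Constant (x + y) (p ℚ.+ q)
constant-+ x y x≡p y≡q n = ≡.cong₂ ℚ._+_ (x≡p n) (y≡q n)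

constant-* : ∀ x y {p q} → Constant x p → Constant y q → Constant (x * y) (p ℚ.* q)
constant-* x y x≡p y≡q n = ≡.cong₂ ℚ._*_ (x≡p n) (y≡q n)

constant-neg : ∀ x {p} → Constant x p → Constant (- x) (ℚ.- p)
constant-neg x x≡p n = ≡.cong ℚ.-_ (x≡p n)

ℝ-apartnessRing : ApartnessRing _ _ _ _
ℝ-apartnessRing = record
  { commutativeRing = ℝ-commutativeRing
  ; _#_             = _#_
  ; #-sym           = λ {x} {y} → #-sym {x} {y}
  ; #-cotrans       = λ {x} {y} → #-cotrans {x} {y}
  ; x#y⇒x-y#0       = λ {x} {y} → x#y⇒x-y#0 {x} {y}
  ; *-#0            = λ {x} {y} → *-#0 {x} {y}
  ; x#0∧xy≈0⇒y≈0    = λ {x} {y} → x#0∧xy≈0⇒y≈0 {x} {y}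
  ; _≐_             = Constant
  ; ≐-0             = λ _ → ≡.refl
  ; ≐-1             = λ _ → ≡.refl
  ; ≐-+             = λ {x} {y} {p} {q} → constant-+ x y {p} {q}
  ; ≐-*             = λ {x} {y} {p} {q} → constant-* x y {p} {q}
  ; ≐-neg           = λ {x} {p} → constant-neg x {p}
  ; ≐-#             = λ {x} {y} {p} {q} → constant-# {x} {y} {p} {q}
  }

-- The subset graph over the real numbers

open SubsetSpectrum ℝ-apartnessRing
  using (HasEigenvalue; subsetAdjacency; eigenvalues; eigenvalues-apart; eigenvalues-sound; eigenvalues-complete)

open Algebra.Properties.Monoid.Sum (CommutativeRing.+-monoid ℝ-commutativeRing) using ()
  renaming (sum-cong-≗ to ℝ-sum-cong-≗)

-- Stated for variable matrices and eigenvalues: for concrete ones, checking that the operations of the ring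
-- are those of ℝ would unfold the Cauchy sequences.
HasEigenvalue⇒IsEigenvalue : ∀ {m} (A A′ : Matrix m) → (∀ i j → A i j ≡ A′ i j) →
                             ∀ μ → HasEigenvalue A μ → IsEigenvalue A′ μ
HasEigenvalue⇒IsEigenvalue A A′ A≗A′ μ (v , v#0 , Av≈μv) = v , v#0 , λ i →
  ≡.subst (_≈ μ * v i) (ℝ-sum-cong-≗ (λ j → ≡.cong (_* v j) (A≗A′ i j))) (Av≈μv i)

IsEigenvalue⇒HasEigenvalue : ∀ {m} (A A′ : Matrix m) → (∀ i j → A i j ≡ A′ i j) →
                             ∀ μ → IsEigenvalue A′ μ → HasEigenvalue A μ
IsEigenvalue⇒HasEigenvalue A A′ A≗A′ μ (v , v#0 , Av≈μv) = v , v#0 , λ i →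
  ≡.subst (_≈ μ * v i) (≡.sym (ℝ-sum-cong-≗ (λ j → ≡.cong (_* v j) (A≗A′ i j)))) (Av≈μv i)

spectrum-in-ℝ : ∀ {k m} (A A′ : Matrix m) (θ : Vector ℝ k) → (∀ i j → A i j ≡ A′ i j) →
  (∀ i j → i ≢ j → ApartnessRing._#_ ℝ-apartnessRing (θ i) (θ j)) →
  (∀ i → HasEigenvalue A (θ i)) →
  (∀ μ → HasEigenvalue A μ → ∃[ i ] ApartnessRing._≈_ ℝ-apartnessRing μ (θ i)) →
  HasExactlyDistinctEigenvalues k A′
spectrum-in-ℝ A A′ θ A≗A′ apart sound complete = θ , apart
  , (λ i → HasEigenvalue⇒IsEigenvalue A A′ A≗A′ (θ i) (sound i))
  , (λ μ μ-eigenvalue → complete μ (IsEigenvalue⇒HasEigenvalue A A′ A≗A′ μ μ-eigenvalue))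

subsetGraph : ℕ → Graph
subsetGraph n = incidenceGraph (nonemptySubset n)

subsetGraph-distinctValencies : ∀ n → n ℕ.≤ length (Graph.distinctValencies (subsetGraph n))
subsetGraph-distinctValencies n = distinctValencies-≥ (subsetGraph n) (suc ∘ toℕ)
  (toℕ-injective ∘ ℕₚ.suc-injective)
  (λ k → let b , size-b = nonemptySubset-of-size n k in
    n ↑ʳ b , ≡.trans (block-valency (nonemptySubset n) b) size-b)

-- `does (T? b)` computes to `b`, so both matrices have the same conditional as entry.
subsetGraph-adjacencyMatrix : ∀ n u w → subsetAdjacency n u w ≡ Graph.adjacencyMatrix (subsetGraph n) u w
subsetGraph-adjacencyMatrix n u w = ≡.refl

subsetGraph-spectrum : ∀ e k → suc (suc k) ℕ.* suc (suc k) ≡ suc (suc (suc (e ℕ.+ e))) →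
  HasExactlyDistinctEigenvalues 5 (Graph.adjacencyMatrix (subsetGraph (suc (suc (e ℕ.+ e)))))
subsetGraph-spectrum e k ss≡ =
  spectrum-in-ℝ (subsetAdjacency (suc (suc (e ℕ.+ e))))
    (Graph.adjacencyMatrix (subsetGraph (suc (suc (e ℕ.+ e))))) (eigenvalues e k ss≡)
    (subsetGraph-adjacencyMatrix (suc (suc (e ℕ.+ e))))
    (eigenvalues-apart e k ss≡) (eigenvalues-sound e k ss≡) (eigenvalues-complete e k ss≡)

i≤+∣i∣ : ∀ i → i ≤ + ℤ.∣ i ∣
i≤+∣i∣ (+ m)    = ℤ.+≤+ ℕₚ.≤-refl
i≤+∣i∣ -[1+ m ] = ℤ.-≤+

subsetGraph-witness : ∀ t e k → suc (suc k) ℕ.* suc (suc k) ≡ suc (suc (suc (e ℕ.+ e))) →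
  t ≤ + suc (suc (e ℕ.+ e)) → Σ[ G ∈ Graph ]
    ( Graph.Connected G
    × Graph.Bipartite G
    × HasExactlyDistinctEigenvalues 5 (Graph.adjacencyMatrix G)
    × t ≤ + length (Graph.distinctValencies G) )
subsetGraph-witness t e k ss≡ t≤n = subsetGraph (suc (suc (e ℕ.+ e)))
  , incidenceGraph-connected (nonemptySubset (suc (suc (e ℕ.+ e))))
      (nonemptySubset-full (suc (e ℕ.+ e))) (nonemptySubset-nonempty (suc (suc (e ℕ.+ e))))
  , incidenceGraph-bipartite (nonemptySubset (suc (suc (e ℕ.+ e))))
  , subsetGraph-spectrum e k ss≡
  , ℤₚ.≤-trans t≤n (ℤ.+≤+ (subsetGraph-distinctValencies (suc (suc (e ℕ.+ e)))))

theorem1 : (t : ℤ) → Σ[ G ∈ Graph ]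
    ( Graph.Connected G
    × Graph.Bipartite G
    × HasExactlyDistinctEigenvalues 5 (Graph.adjacencyMatrix G)
    × t ≤ + length (Graph.distinctValencies G) )
theorem1 t = subsetGraph-witness t e (suc (m ℕ.+ m)) (square m)
  (ℤₚ.≤-trans (i≤+∣i∣ t) (ℤ.+≤+ m≤n))
  where
  m e : ℕ
  m = ℤ.∣ t ∣
  -- From s = 3 + 2m, the number (s² - 3)/2 is 2m² + 6m + 3; splitting off one summand m makes m ≤
  -- e, and hence t ≤ v, immediate.
  e = m ℕ.+ (m ℕ.* m ℕ.+ m ℕ.* m ℕ.+ 5 ℕ.* m ℕ.+ 3)
  m≤n : m ℕ.≤ suc (suc (e ℕ.+ e))
  m≤n = ℕₚ.m≤n⇒m≤1+n (ℕₚ.m≤n⇒m≤1+n (ℕₚ.≤-trans (ℕₚ.m≤m+n m _) (ℕₚ.m≤m+n e e)))
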